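{- For every elementary wqo $E$ given by an expression in normal form, $\mathbf{h}(\mathcal{P}_f(E))=\underline{\mathbf{o}}(E)$.
   Context: A wqo is a quasi-order in which every infinite sequence has $i<j$ with $x_i\le x_j$. $\mathbf{o}(A),\mathbf{h}(A),\mathbf{w}(A)$ are the ranks of the roots of the well-founded trees of finite bad sequences, finite strictly decreasing sequences, and finite sequences of pairwise incomparable elements of $A$ (root: empty sequence, children: one-element extensions; rank $r(s)=\sup\{r(t)+1: t\text{ child of } s\}$). Multiplicatively indecomposable ordinals $\ge\omega$ are those of the form $\omega^{\omega^\gamma}$; an ordinal $\alpha$ is viewed as the wqo $(\alpha,\le)$. Constructions: $E_1\sqcup E_2$ disjoint union ordered by $\le_{E_1}\cup\le_{E_2}$; $E_1\times E_2$ Cartesian product with componentwise order; $E^{<\omega}$ finite words with subword embedding; $\mathsf{M}^\diamond(E)$ finite multisets with multiset embedding, and $\mathsf{M}^\diamond_n(E)$ its restriction to multisets of exactly $n$ elements; $\mathcal{P}_f(E)$ finite subsets with Hoare embedding ($S\le_H S'$ iff $\forall a\in S\,\exists b\in S'\,a\le b$); $E^{\times n}$ the $n$-fold Cartesian power. Elementary wqos are given by expressions of the grammar $E::=\alpha\ (\alpha\ge\omega^\omega\text{ multiplicatively indecomposable})\mid E_1\sqcup E_2\mid E_1\times E_2\mid E^{<\omega}\mid\mathsf{M}^\diamond(E)\mid\mathcal{P}_f(E)$; such an expression is in normal form if no subexpression can be rewritten by the rules $\mathcal{P}_f(\alpha)\to\alpha$; $E\times(E_1\sqcup E_2)\to(E\times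 E_1)\sqcup(E\times E_2)$; $(E_1\sqcup E_2)\times E\to(E_1\times E)\sqcup(E_2\times E)$; $\mathsf{M}^\diamond(E_1\sqcup E_2)\to\mathsf{M}^\diamond(E_1)\times\mathsf{M}^\diamond(E_2)$; $\mathcal{P}_f(E_1\sqcup E_2)\to\mathcal{P}_f(E_1)\times\mathcal{P}_f(E_2)$. Two wqos are wpo-isomorphic ($\cong_{wpo}$) if their quotients by $x\equiv y\iff x\le y\le x$ are isomorphic. Approximation $E'<_{\mathrm{approx}}E$ (by recursion on the expression $E$): if $E=\alpha$, $E'\cong_{wpo}\alpha'$ for some $\alpha'<\alpha$; if $E=E_1\sqcup E_2$ (resp. $E_1\times E_2$), $E'\cong_{wpo}E_1'\sqcup E_2'$ (resp. $E_1'\times E_2'$) with $E_i'<_{\mathrm{approx}}E_i$; if $E=E_1^{<\omega}$, $E'\cong_{wpo}(E_1')^{\times n}$ with $E_1'<_{\mathrm{approx}}E_1$, $n<\omega$; if $E=\mathsf{M}^\diamond(E_1)$, $E'\cong_{wpo}\mathsf{M}^\diamond_n(E_1')$ with $E_1'<_{\mathrm{approx}}E_1$, $n<\omega$; if $E=\mathcal{P}_f(E_1)$, $E'\cong_{wpo}\mathcal{P}_f(E_1')$ with $E_1'<_{\mathrm{approx}}E_1$. For $\mathbf{f}\in\{\mathbf{o},\mathbf{h},\mathbf{w}\}$, the weakened invariant is $\underline{\mathbf{f}}(E)=\sup\{\mathbf{f}(E')+1: E'<_{\mathrm{approx}}E\}$. -}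

module Defs where

open import Axiom.ExcludedMiddle using (ExcludedMiddle)
open import Data.Empty using (⊥; ⊥-elim)
open import Data.Fin.Base using (Fin)
open import Data.List.Base using (List; []; _∷_; length; lookup)
import Data.List.Relation.Binary.Sublist.Heterogeneous.Properties as Sublist
open import Data.List.Relation.Unary.All as All using (All)
open import Data.List.Relation.Unary.Any as Any using (Any)
open import Data.List.Membership.Propositional using (_∈_; find; lose)
open import Data.Maybe.Base using (Maybe; nothing; just)
open import Data.Nat.Base using (ℕ; zero; suc; _<_; _<′_; <′-base; <′-step)
open import Data.Nat.Properties using (<⇒<′)
open import Data.Product using (Σ; Σ-syntax; ∃; ∃₂; ∃-syntax; _×_; _,_; proj₁; proj₂)
open import Data.Product.Relation.Binary.Pointwise.NonDependent using (×-preorder)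
open import Data.Sum.Base using (_⊎_; [_,_])
open import Data.Sum.Relation.Binary.Pointwise using (⊎-preorder)
open import Data.Unit.Base using (⊤)
open import Function.Bundles using (_↣_; Injection)
open import Function.Construct.Composition using (_↣-∘_)
open import Function.Construct.Identity using (↣-id)
open import Induction.WellFounded using (Acc; acc)
open import Level using (Level; Lift; lift; lower) renaming (suc to lsuc; _⊔_ to _⊔ˡ_)
open import Relation.Binary.Bundles using (Preorder; Poset)
import Relation.Binary.Construct.Interior.Symmetric as Interior
import Relation.Binary.Construct.On as On
open import Relation.Binary.Core using (Rel)
open import Relation.Binary.Definitions using (Reflexive; Transitive)
open import Relation.Binary.Morphism.Structures using (IsOrderIsomorphism)
open import Relation.Binary.PropositionalEquality using (_≡_; refl)
open import Relation.Nullary using (¬_; yes; no)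

private
  variable
    a b ℓ : Level

-- sup⁺ I f denotes the ordinal sup { f i + 1 : i ∈ I }.  Every ordinal α is
-- of this form (take for f an enumeration of the ordinals below α).  Distinct
-- trees may denote the same ordinal: equality of ordinals is _≈ᵒ_.
-- Since a rank may live in a higher universe than the order it is computed
-- from, ordinals of different levels have to be comparable.
data Ord ℓ : Set (lsuc ℓ) where
  sup⁺ : (I : Set ℓ) → (I → Ord ℓ) → Ord ℓ

infix 4 _≤ᵒ_ _<ᵒ_ _≈ᵒ_
infixl 6 _+ᵒ_
infixl 7 _·_

_≤ᵒ_ : Ord a → Ord b → Set (a ⊔ˡ b)
_<ᵒ_ : Ord a → Ord b → Set (a ⊔ˡ b)
sup⁺ I f ≤ᵒ β        = ∀ i → f i <ᵒ β
α        <ᵒ sup⁺ J g = ∃[ j ] α ≤ᵒ g j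

_≈ᵒ_ : Ord a → Ord b → Set (a ⊔ˡ b)
α ≈ᵒ β = α ≤ᵒ β × β ≤ᵒ α

_+ᵒ_ : Ord ℓ → Ord ℓ → Ord ℓ
sup⁺ I f +ᵒ sup⁺ J g = sup⁺ (I ⊎ J) [ f , (λ j → sup⁺ I f +ᵒ g j) ]

0ᵒ : Ord ℓ
0ᵒ {ℓ} = sup⁺ (Lift ℓ ⊥) (λ ())

_·_ : Ord ℓ → ℕ → Ord ℓ
α · zero  = 0ᵒ
α · suc n = α · n +ᵒ α

-- ω^β = sup ({1} ∪ { ω^γ · n + 1 : γ < β, n < ω }).
ω^_ : Ord ℓ → Ord ℓ
ω^ sup⁺ J g = sup⁺ (Maybe (J × ℕ)) λ where
  nothing        → 0ᵒ
  (just (j , n)) → ω^ (g j) · n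

finite : ℕ → Ord ℓ
finite {ℓ} zero    = 0ᵒ
finite {ℓ} (suc n) = sup⁺ (Lift ℓ ⊤) (λ _ → finite n)

ω : Ord ℓ
ω {ℓ} = sup⁺ (Lift ℓ ℕ) (λ n → finite (lower n))

raise : Ord ℓ → Ord (lsuc ℓ)
raise (sup⁺ I f) = sup⁺ (Lift _ I) (λ i → raise (f (lower i)))

-- The multiplicatively indecomposable ordinals ≥ ω are those of the form
-- ω^(ω^γ); the finite ones are not included here.
MultIndecomposable : Ord ℓ → Set (lsuc ℓ)
MultIndecomposable {ℓ} α = Σ[ γ ∈ Ord ℓ ] α ≈ᵒ ω^ (ω^ γ)

≤ᵒ-refl : (α : Ord ℓ) → α ≤ᵒ α
≤ᵒ-refl (sup⁺ I f) i = i , ≤ᵒ-refl (f i)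

≤ᵒ-trans : (α β γ : Ord ℓ) → α ≤ᵒ β → β ≤ᵒ γ → α ≤ᵒ γ
≤ᵒ-trans (sup⁺ I f) (sup⁺ J g) (sup⁺ K h) p q i =
  let j , fi≤gj = p i
      k , gj≤hk = q j
  in  k , ≤ᵒ-trans (f i) (g j) (h k) fi≤gj gj≤hk

-- Only _≲_ matters below; the underlying equality of a Preorder is ignored.
QO : ∀ ℓ → Set (lsuc ℓ)
QO ℓ = Preorder ℓ ℓ ℓ

quasiOrder : {A : Set ℓ} (_≲_ : Rel A ℓ) → Reflexive _≲_ → Transitive _≲_ → QO ℓ
quasiOrder _≲_ r t = record { isPreorder = Interior.isPreorder {R = _≲_} r t }

IsWQO : QO ℓ → Set ℓ
IsWQO A = ∀ (x : ℕ → Carrier) → ∃₂ λ i j → i < j × x i ≲ x j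
  where open Preorder A

WQO : ∀ ℓ → Set (lsuc ℓ)
WQO ℓ = Σ (QO ℓ) IsWQO

-- The quotient of A by x ≲ y ≲ x, as a setoid: its equality is that relation.
quotient : QO ℓ → Poset ℓ ℓ ℓ
quotient A = Interior.poset {R = _≲_} (Preorder.refl A) (Preorder.trans A)
  where open Preorder A

infix 4 _≅_
_≅_ : QO ℓ → QO ℓ → Set ℓ
A ≅ B = ∃ (IsOrderIsomorphism A/≡._≈_ B/≡._≈_ A/≡._≤_ B/≡._≤_)
  where
  module A/≡ = Poset (quotient A)
  module B/≡ = Poset (quotient B)

segment : Ord ℓ → QO (lsuc ℓ)
segment {ℓ} α = quasiOrder {A = Σ[ β ∈ Ord ℓ ] β <ᵒ α}
  (λ (β , _) (γ , _) → Lift (lsuc ℓ) (β ≤ᵒ γ))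
  (λ {(β , _)} → lift (≤ᵒ-refl β))
  (λ {(β , _)} {(γ , _)} {(δ , _)} p q → lift (≤ᵒ-trans β γ δ (lower p) (lower q)))

infixr 5 _⊔_
_⊔_ : QO ℓ → QO ℓ → QO ℓ
A ⊔ B = ⊎-preorder A B

infixr 6 _⊗_
_⊗_ : QO ℓ → QO ℓ → QO ℓ
A ⊗ B = ×-preorder A B

Power : QO ℓ → ℕ → QO ℓ
Power A n = quasiOrder {A = Fin n → Carrier}
  (λ u v → ∀ i → u i ≲ v i)
  (λ i → Preorder.refl A)
  (λ p q i → Preorder.trans A (p i) (q i))
  where open Preorder A

Words : QO ℓ → QO ℓ
Words A = Sublist.preorder A

-- Multisets are represented by lists; lists that are permutations of one
-- another embed into each other.
Multisets : QO ℓ → QO ℓ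
Multisets A = quasiOrder {A = List Carrier}
  (λ xs ys → Σ[ f ∈ Fin (length xs) ↣ Fin (length ys) ]
     ∀ i → lookup xs i ≲ lookup ys (Injection.to f i))
  (↣-id _ , λ i → Preorder.refl A)
  (λ (f , p) (g , q) → g ↣-∘ f , λ i → Preorder.trans A (p i) (q (Injection.to f i)))
  where open Preorder A

MultisetsOfSize : ℕ → QO ℓ → QO ℓ
MultisetsOfSize n A = On.preorder (Multisets A) (proj₁ {B = λ xs → length xs ≡ n})

-- Finite subsets are represented by lists; lists with the same elements are
-- below each other.
FiniteSubsets : QO ℓ → QO ℓ
FiniteSubsets A = quasiOrder {A = List Carrier}
  (λ S S′ → All (λ x → Any (x ≲_) S′) S)
  (All.tabulate λ x∈S → lose x∈S (Preorder.refl A))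
  (λ p q → All.map (λ x≲S′ → let y , y∈S′ , x≲y = find x≲S′ in
                              Any.map (Preorder.trans A x≲y) (All.lookup q y∈S′)) p)
  where open Preorder A

rank : {T : Set ℓ} {_◃_ : Rel T ℓ} {s : T} → Acc _◃_ s → Ord ℓ
rank {_◃_ = _◃_} {s} (acc rs) = sup⁺ (∃[ t ] t ◃ s) (λ (_ , t◃s) → rank (rs t◃s))

-- The tree of finite sequences in which R x y holds whenever x comes later than
-- y.  Sequences are listed with the latest entry first; lists violating this
-- condition are not reachable from the root [].
data Child {A : Set ℓ} (R : Rel A ℓ) : Rel (List A) ℓ where
  extend : ∀ {x s} → All (R x) s → Child R (x ∷ s) s

module _ (A : QO ℓ) where
  open Preorder A

  NotAbove : Rel Carrier ℓ
  NotAbove x y = ¬ y ≲ x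

  StrictlyBelow : Rel Carrier ℓ
  StrictlyBelow x y = x ≲ y × ¬ y ≲ x

-- Over a wqo these trees are well-founded, classically: an infinite branch
-- would be an infinite bad sequence.
module _ (em : ∀ {ℓ} → ExcludedMiddle ℓ) (A : QO ℓ) (wqo : IsWQO A) where
  open Preorder A using (Carrier; _≲_)

  module _ {R : Rel Carrier ℓ} (R⇒bad : ∀ {x y} → R x y → ¬ y ≲ x) where

    private
      Bad : Set ℓ
      Bad = ∃[ s ] ¬ Acc (Child R) s

      step : (s : Bad) → ∃[ x ] All (R x) (proj₁ s) × ¬ Acc (Child R) (x ∷ proj₁ s)
      step (s , ¬acc) with em {P = ∃[ x ] All (R x) s × ¬ Acc (Child R) (x ∷ s)}
      ... | yes p = p
      ... | no ¬p = ⊥-elim (¬acc (acc λ where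
        (extend {x} r) → accessible x r))
        where
        accessible : ∀ x → All (R x) s → Acc (Child R) (x ∷ s)
        accessible x r with em {P = Acc (Child R) (x ∷ s)}
        ... | yes q = q
        ... | no ¬q = ⊥-elim (¬p (x , r , ¬q))

      next : Bad → Bad
      next s = let x , _ , ¬acc = step s in x ∷ proj₁ s , ¬acc

      module Branch (root : Bad) where
        node : ℕ → Bad
        node zero    = root
        node (suc n) = next (node n)

        entry : ℕ → Carrier
        entry n = proj₁ (step (node n))

        entry∈node : ∀ {i j} → i <′ j → entry i ∈ proj₁ (node j)
        entry∈node <′-base     = Any.here refl
        entry∈node (<′-step p) = Any.there (entry∈node p)

        entries-bad : ∀ {i j} → i < j → ¬ entry i ≲ entry j
        entries-bad {j = j} i<j =
          let _ , compatible , _ = step (node j)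
          in  R⇒bad (All.lookup compatible (entry∈node (<⇒<′ i<j)))

    tree-wellFounded : Acc (Child R) []
    tree-wellFounded with em {P = Acc (Child R) []}
    ... | yes p = p
    ... | no ¬p = let open Branch ([] , ¬p)
                      _ , _ , i<j , good = wqo entry
                  in  ⊥-elim (entries-bad i<j good)

o : (∀ {ℓ} → ExcludedMiddle ℓ) → WQO ℓ → Ord ℓ
o em (A , wqo) = rank (tree-wellFounded em A wqo {R = NotAbove A} λ r → r)

h : (∀ {ℓ} → ExcludedMiddle ℓ) → WQO ℓ → Ord ℓ
h em (A , wqo) = rank (tree-wellFounded em A wqo {R = StrictlyBelow A} proj₂)

infixr 5 _⊔ᵉ_
infixr 6 _×ᵉ_

data Expr ℓ : Set (lsuc ℓ) where
  ordinal : (α : Ord ℓ) → ω^ ω {ℓ} ≤ᵒ α → MultIndecomposable α → Expr ℓ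
  _⊔ᵉ_    : Expr ℓ → Expr ℓ → Expr ℓ
  _×ᵉ_    : Expr ℓ → Expr ℓ → Expr ℓ
  words   : Expr ℓ → Expr ℓ
  M⋄      : Expr ℓ → Expr ℓ
  Pf      : Expr ℓ → Expr ℓ

⟦_⟧ : Expr ℓ → QO (lsuc ℓ)
⟦ ordinal α _ _ ⟧ = segment α
⟦ E₁ ⊔ᵉ E₂ ⟧      = ⟦ E₁ ⟧ ⊔ ⟦ E₂ ⟧
⟦ E₁ ×ᵉ E₂ ⟧      = ⟦ E₁ ⟧ ⊗ ⟦ E₂ ⟧
⟦ words E ⟧       = Words ⟦ E ⟧
⟦ M⋄ E ⟧          = Multisets ⟦ E ⟧
⟦ Pf E ⟧          = FiniteSubsets ⟦ E ⟧

infix 4 _⟶_ _⊑_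

data _⟶_ {ℓ} : Expr ℓ → Expr ℓ → Set (lsuc ℓ) where
  Pf-ordinal : ∀ {α p q}    → Pf (ordinal α p q) ⟶ ordinal α p q
  ×-distribˡ : ∀ {E E₁ E₂}  → E ×ᵉ (E₁ ⊔ᵉ E₂) ⟶ (E ×ᵉ E₁) ⊔ᵉ (E ×ᵉ E₂)
  ×-distribʳ : ∀ {E E₁ E₂}  → (E₁ ⊔ᵉ E₂) ×ᵉ E ⟶ (E₁ ×ᵉ E) ⊔ᵉ (E₂ ×ᵉ E)
  M⋄-⊔       : ∀ {E₁ E₂}    → M⋄ (E₁ ⊔ᵉ E₂) ⟶ M⋄ E₁ ×ᵉ M⋄ E₂
  Pf-⊔       : ∀ {E₁ E₂}    → Pf (E₁ ⊔ᵉ E₂) ⟶ Pf E₁ ×ᵉ Pf E₂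

data _⊑_ {ℓ} (F : Expr ℓ) : Expr ℓ → Set (lsuc ℓ) where
  here     : F ⊑ F
  in-⊔ˡ    : ∀ {E₁ E₂} → F ⊑ E₁ → F ⊑ E₁ ⊔ᵉ E₂
  in-⊔ʳ    : ∀ {E₁ E₂} → F ⊑ E₂ → F ⊑ E₁ ⊔ᵉ E₂
  in-×ˡ    : ∀ {E₁ E₂} → F ⊑ E₁ → F ⊑ E₁ ×ᵉ E₂
  in-×ʳ    : ∀ {E₁ E₂} → F ⊑ E₂ → F ⊑ E₁ ×ᵉ E₂
  in-words : ∀ {E}    → F ⊑ E → F ⊑ words E
  in-M⋄    : ∀ {E}    → F ⊑ E → F ⊑ M⋄ E
  in-Pf    : ∀ {E}    → F ⊑ E → F ⊑ Pf E

NormalForm : Expr ℓ → Set (lsuc ℓ)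
NormalForm E = ∀ {F G} → F ⊑ E → ¬ (F ⟶ G)

infix 4 _<approx_

data _<approx_ {ℓ} (E′ : QO (lsuc ℓ)) : Expr ℓ → Set (lsuc (lsuc ℓ)) where
  ordinal : ∀ {α p q} {α′ : Ord ℓ} → α′ <ᵒ α →
            E′ ≅ segment α′ → E′ <approx ordinal α p q
  sum     : ∀ {E₁ E₂ E₁′ E₂′} → E₁′ <approx E₁ → E₂′ <approx E₂ →
            E′ ≅ E₁′ ⊔ E₂′ → E′ <approx E₁ ⊔ᵉ E₂
  product : ∀ {E₁ E₂ E₁′ E₂′} → E₁′ <approx E₁ → E₂′ <approx E₂ →
            E′ ≅ E₁′ ⊗ E₂′ → E′ <approx E₁ ×ᵉ E₂
  words   : ∀ {E₁ E₁′} (n : ℕ) → E₁′ <approx E₁ →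
            E′ ≅ Power E₁′ n → E′ <approx words E₁
  M⋄      : ∀ {E₁ E₁′} (n : ℕ) → E₁′ <approx E₁ →
            E′ ≅ MultisetsOfSize n E₁′ → E′ <approx M⋄ E₁
  Pf      : ∀ {E₁ E₁′} → E₁′ <approx E₁ →
            E′ ≅ FiniteSubsets E₁′ → E′ <approx Pf E₁

o-weakened : (∀ {ℓ} → ExcludedMiddle ℓ) → Expr ℓ → Ord (lsuc (lsuc ℓ))
o-weakened {ℓ} em E = sup⁺ (Σ[ A ∈ WQO (lsuc ℓ) ] proj₁ A <approx E) (λ (A , _) → raise (o em A))

{-# OPTIONS --safe #-}

-- Upper bound.  In a strictly decreasing sequence S₁ > S₂ > … of finite subsets of E, pick
-- xᵢ ∈ Sᵢ outside the down-closure of Sᵢ₊₁: the xᵢ form a bad sequence in ↓ S₁.  The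
-- down-closure of a finite subset of E embeds into an approximation of E, so the rank of S₁
-- is at most the maximal order type of that approximation.
--
-- Lower bound.  Every ideal of an approximation E′ of E can be coded by a point of E, in such
-- a way that inclusion of finite unions of ideals becomes the Hoare order.  The residuals of
-- E′ along a bad sequence are such finite unions, so they give a strictly decreasing sequence
-- of finite subsets of E.

module Submission where

open import Axiom.ExcludedMiddle using (ExcludedMiddle)
open import Data.Empty using (⊥; ⊥-elim)
open import Data.Fin.Base using (Fin; zero; suc; cast; toℕ; inject≤; punchOut)
import Data.Fin.Properties as Fin
open import Data.List.Base using (List; []; _∷_; length; _++_; lookup; map; concat; tabulate;
  mapMaybe; concatMap; allFin; cartesianProductWith)
open import Data.List.Membership.Propositional using (find; lose)
open import Data.List.Membership.Propositional.Properties using (∈-lookup; ∈-allFin)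
open import Data.List.Properties using (length-tabulate; lookup-tabulate; length-++)
import Data.List.Relation.Binary.Pointwise as Pointwise
open import Data.List.Relation.Binary.Sublist.Heterogeneous using (Sublist; []; _∷_; _∷ʳ_; minimum)
import Data.List.Relation.Binary.Sublist.Heterogeneous.Properties as Sublist
open import Data.List.Relation.Unary.All as All using (All; []; _∷_)
import Data.List.Relation.Unary.All.Properties as All
open import Data.List.Relation.Unary.Any as Any using (Any; here; there)
import Data.List.Relation.Unary.Any.Properties as Any
open import Data.Maybe.Base using (nothing; just)
open import Data.Nat.Base using (ℕ; zero; suc; _+_; _∸_; _≤_; _<_; _<′_; <′-base; <′-step; z<s; s≤s)
open import Data.Nat.Induction using (<-wellFounded)
import Data.Nat.Properties as ℕ
open import Data.Product using (∃; Σ-syntax; ∃-syntax; ∃₂; _×_; _,_; proj₁; proj₂)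
open import Data.Sum.Base as Sum using (_⊎_; inj₁; inj₂)
open import Data.Sum.Relation.Binary.Pointwise as ⊎ using (inj₁; inj₂)
open import Data.Unit.Base using (⊤)
open import Data.Vec.Functional as Vector using (updateAt)
open import Data.Vec.Functional.Properties using (updateAt-updates; updateAt-minimal)
open import Function.Base using (_∘_; id; const)
open import Function.Bundles using (_↣_; Injection; mk↣)
open import Function.Construct.Composition using (_↣-∘_)
open import Function.Construct.Identity using (↣-id)
open import Induction.WellFounded using (Acc; acc)
open import Level using (Level; Lift; lift; lower) renaming (suc to lsuc)
open import Relation.Binary.Bundles using (Preorder)
open import Relation.Binary.Construct.Interior.Symmetric using (_,_)
open import Relation.Binary.Core using (Rel; REL)
open import Relation.Binary.Definitions using (Transitive)
open import Relation.Binary.Morphism.Structures using (IsOrderIsomorphism)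
open import Relation.Binary.PropositionalEquality using (_≡_; refl; sym; trans; cong; subst; subst₂; _≢_; setoid)
open import Relation.Nullary using (¬_; yes; no)
open import Relation.Nullary.Decidable using (decidable-stable)
open import Defs

-- An approximation of words or multisets has one fixed size, whereas a down-closure also contains
-- all smaller sizes. Short lists must be filled up with a point that cannot be mistaken for a
-- genuine entry; room for it is made by moving `E` onto a copy of itself inside `E`, none of whose
-- points lies below the filler. In the end this rests on the ordinals of an expression being
-- positive limits. In the other direction, an ideal of an ordinal `α′ < α` is a nonempty initial
-- segment, coded by its length `β`. The whole of `α′` is one of them, and its code `α′` is a point
-- of `α` because the approximation is strictly smaller. All other codes are assembled from these.
-- In both bounds the decreasing sequence is one set longer than the bad sequence: its first set
-- accounts for the `+ 1` in the weakened invariant.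

private
  variable
    a b c p r ℓ : Level

∣_∣ : QO ℓ → Set ℓ
∣ A ∣ = Preorder.Carrier A

Below : (A : QO ℓ) → ∣ A ∣ → ∣ A ∣ → Set ℓ
Below A = Preorder._≲_ A

infix 4 Below
syntax Below A x y = x ≤[ A ] y

wqo-reflect : {A : QO a} {B : QO b} (f : ∣ B ∣ → ∣ A ∣) →
  (∀ x y → f x ≤[ A ] f y → x ≤[ B ] y) → IsWQO A → IsWQO B
wqo-reflect f reflects wqo x =
  let i , j , i<j , fxᵢ≤fxⱼ = wqo (f ∘ x) in i , j , i<j , reflects _ _ fxᵢ≤fxⱼ

chain : {T : ℕ → ℕ → Set p} → Transitive T → (∀ n → T n (suc n)) → ∀ {i j} → i < j → T i j
chain {T = T} T-trans step i<j = go (ℕ.<⇒<′ i<j)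
  where
  go : ∀ {i j} → i <′ j → T i j
  go <′-base     = step _
  go (<′-step q) = T-trans (go q) (step _)

-- Ordinals

<ᵒ⇒≤ᵒ : (α : Ord a) (β : Ord b) → α <ᵒ β → α ≤ᵒ β
<ᵒ⇒≤ᵒ (sup⁺ I f) (sup⁺ J g) (j , α≤gj) i = j , <ᵒ⇒≤ᵒ (f i) (g j) (α≤gj i)

-- Ranks, their `raise` and the weakened invariant live at different levels, whereas `≤ᵒ-trans`
-- stays at one.
≤ᵒ-transʰ : (α : Ord a) (β : Ord b) (γ : Ord c) → α ≤ᵒ β → β ≤ᵒ γ → α ≤ᵒ γ
≤ᵒ-transʰ (sup⁺ I f) (sup⁺ J g) (sup⁺ K h) p q i =
  let j , fi≤gj = p i
      k , gj≤hk = q j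
  in  k , ≤ᵒ-transʰ (f i) (g j) (h k) fi≤gj gj≤hk

≤-<-transᵒ : (α : Ord a) (β : Ord b) (γ : Ord c) → α ≤ᵒ β → β <ᵒ γ → α <ᵒ γ
≤-<-transᵒ α β (sup⁺ K h) α≤β (k , β≤hk) = k , ≤ᵒ-transʰ α β (h k) α≤β β≤hk

<-≤-transᵒ : (α : Ord a) (β : Ord b) (γ : Ord c) → α <ᵒ β → β ≤ᵒ γ → α <ᵒ γ
<-≤-transᵒ α (sup⁺ J g) γ (j , α≤gj) β≤γ = ≤-<-transᵒ α (g j) γ α≤gj (β≤γ j)

<ᵒ-irrefl : (α : Ord a) → ¬ α <ᵒ α
<ᵒ-irrefl (sup⁺ I f) (i , α≤fi) = <ᵒ-irrefl (f i) (α≤fi i)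

0≤ᵒ : (α : Ord ℓ) → 0ᵒ {ℓ} ≤ᵒ α
0≤ᵒ α ()

sucᵒ : Ord ℓ → Ord ℓ
sucᵒ {ℓ} α = sup⁺ (Lift ℓ ⊤) (λ _ → α)

<ᵒ-sucᵒ : (α : Ord ℓ) → α <ᵒ sucᵒ α
<ᵒ-sucᵒ α = _ , ≤ᵒ-refl α

≤ᵒ-+ᵒ : (α β : Ord ℓ) → α ≤ᵒ α +ᵒ β
≤ᵒ-+ᵒ (sup⁺ I f) (sup⁺ J g) i = inj₁ i , ≤ᵒ-refl (f i)

0<ω^ : (δ : Ord ℓ) → 0ᵒ {ℓ} <ᵒ ω^ δ
0<ω^ (sup⁺ J g) = nothing , λ ()

<ᵒ-+ω^ : (α δ : Ord ℓ) → α <ᵒ α +ᵒ ω^ δ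
<ᵒ-+ω^ α@(sup⁺ I f) (sup⁺ J g) = inj₂ nothing , ≤ᵒ-+ᵒ α 0ᵒ

-- An ordinal below `ω^ δ` is at most some `ω^ γ · n` with `γ < δ`, so its successor is at most
-- `ω^ γ · (n + 1)`. Positivity of `δ` supplies a `γ` when the ordinal is 0; it excludes `ω^ 0 = 1`.
ω^-limit : (β δ : Ord ℓ) → 0ᵒ {ℓ} <ᵒ δ → β <ᵒ ω^ δ → sucᵒ β <ᵒ ω^ δ
ω^-limit {ℓ} β (sup⁺ J g) (j₀ , _) = λ where
    (nothing , β≤0)       → next j₀ 0 β≤0
    (just (j , n) , β≤ωn) → next j n β≤ωn
  where
  next : ∀ j n → β ≤ᵒ ω^ (g j) · n → sucᵒ β <ᵒ ω^ (sup⁺ J g)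
  next j n β≤ = just (j , suc n) , λ _ →
    ≤-<-transᵒ β (ω^ (g j) · n) (ω^ (g j) · suc n) β≤ (<ᵒ-+ω^ (ω^ (g j) · n) (g j))

module _ {α : Ord ℓ} (mi : MultIndecomposable α) where
  private
    γ  = proj₁ mi
    α≤ = proj₁ (proj₂ mi)
    ≤α = proj₂ (proj₂ mi)

  multIndecomposable-positive : 0ᵒ {ℓ} <ᵒ α
  multIndecomposable-positive = <-≤-transᵒ 0ᵒ (ω^ (ω^ γ)) α (0<ω^ (ω^ γ)) ≤α

  multIndecomposable-limit : ∀ β → β <ᵒ α → sucᵒ β <ᵒ α
  multIndecomposable-limit β β<α = <-≤-transᵒ (sucᵒ β) (ω^ (ω^ γ)) α
    (ω^-limit β (ω^ γ) (0<ω^ γ) (<-≤-transᵒ β α (ω^ (ω^ γ)) β<α α≤)) ≤α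

-- Orders on finite families

-- Multiset embedding; a record rather than the Σ-type of Multisets, from which Agda could
-- not infer R, u and v.
record Match {A : Set a} {B : Set b} (R : REL A B r) {m n : ℕ} (u : Fin m → A) (v : Fin n → B) : Set r where
  constructor match
  field
    injection : Fin m ↣ Fin n
    related   : ∀ i → R (u i) (v (Injection.to injection i))

match-trans : {A : Set a} {B : Set b} {C : Set c} {R : REL A B p} {S : REL B C r} {T : REL A C ℓ} →
  (∀ {x y z} → R x y → S y z → T x z) →
  ∀ {l m n} {u : Fin l → A} {v : Fin m → B} {w : Fin n → C} →
  Match R u v → Match S v w → Match T u w
match-trans RST (match f p) (match g q) = match (g ↣-∘ f) λ i → RST (p i) (q (Injection.to f i))

match-cast : {A : Set a} {B : Set b} {R : REL A B r} {m n : ℕ} {u : Fin m → A} {v : Fin n → B}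
  (eq : m ≡ n) → (∀ i → R (u i) (v (cast eq i))) → Match R u v
match-cast eq r = match (mk↣ (λ {i} {j} ci≡cj → Fin.toℕ-injective
  (trans (sym (Fin.toℕ-cast eq i)) (trans (cong toℕ ci≡cj) (Fin.toℕ-cast eq j))))) r

module _ {A : Set a} where

  match-tabulate⁺ : ∀ {n} (u : Fin n → A) → Match _≡_ u (lookup (tabulate u))
  match-tabulate⁺ u = match-cast (sym (length-tabulate u)) λ i → sym (lookup-tabulate u i)

  match-tabulate⁻ : ∀ {n} (u : Fin n → A) → Match _≡_ (lookup (tabulate u)) u
  match-tabulate⁻ u = match-cast len λ i → trans
    (cong (lookup (tabulate u)) (sym (Fin.cast-involutive (sym len) len i)))
    (lookup-tabulate u (cast len i))
    where len = length-tabulate u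

  module _ {R : Rel A r} {m n} {u : Fin m → A} {v : Fin n → A} where

    tabulate-match⁺ : Match R u v → Match R (lookup (tabulate u)) (lookup (tabulate v))
    tabulate-match⁺ q = match-trans (λ { refl r → r }) (match-tabulate⁻ u)
      (match-trans (λ { r refl → r }) q (match-tabulate⁺ v))

    tabulate-match⁻ : Match R (lookup (tabulate u)) (lookup (tabulate v)) → Match R u v
    tabulate-match⁻ q = match-trans (λ { refl r → r }) (match-tabulate⁺ u)
      (match-trans (λ { r refl → r }) q (match-tabulate⁻ v))

  module _ {R : Rel A r} where

    sublist⇒match : ∀ {xs ys} → Sublist R xs ys → Match R (lookup xs) (lookup ys)
    sublist⇒match []        = match (↣-id _) λ ()
    sublist⇒match (_ ∷ʳ rs) =
      let match f q = sublist⇒match rs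
      in  match (mk↣ (Injection.injective f ∘ Fin.suc-injective)) q
    sublist⇒match (r ∷ rs)  =
      let match f q = sublist⇒match rs
      in  match (mk↣ (Fin.lift-injective (Injection.to f) (Injection.injective f) 1))
            λ { zero → r ; (suc i) → q i }

    sublist⇒hoare : ∀ {xs ys} → Sublist R xs ys → All (λ x → Any (R x) ys) xs
    sublist⇒hoare []        = []
    sublist⇒hoare (_ ∷ʳ rs) = All.map there (sublist⇒hoare rs)
    sublist⇒hoare (r ∷ rs)  = here r ∷ All.map there (sublist⇒hoare rs)

    match⇒hoare : ∀ {xs ys} → Match R (lookup xs) (lookup ys) → All (λ x → Any (R x) ys) xs
    match⇒hoare {xs} {ys} (match f q) = All.tabulate λ x∈xs →
      lose (∈-lookup (Injection.to f (Any.index x∈xs)))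
        (subst (λ x → R x (lookup ys (Injection.to f (Any.index x∈xs))))
          (sym (Any.lookup-index x∈xs)) (q (Any.index x∈xs)))

    -- Between words of equal length a subword embedding can skip nothing. Hence `tabulate`
    -- identifies the `n`-fold power with the words of length `n`.
    tabulate-sublist⁻ : ∀ {n} (u v : Fin n → A) → Sublist R (tabulate u) (tabulate v) → ∀ i → R (u i) (v i)
    tabulate-sublist⁻ u v = Pointwise.tabulate⁻ ∘
      Sublist.toPointwise (trans (length-tabulate u) (sym (length-tabulate v)))

    tabulate-sublist⁺ : ∀ {n} (u v : Fin n → A) → (∀ i → R (u i) (v i)) → Sublist R (tabulate u) (tabulate v)
    tabulate-sublist⁺ u v = Sublist.fromPointwise ∘ Pointwise.tabulate⁺

≅-refl : {A : QO ℓ} → A ≅ A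
≅-refl = id , record
  { isOrderMonomorphism = record
    { isOrderHomomorphism = record { cong = id ; mono = id }
    ; injective = id
    ; cancel = id
    }
  ; surjective = λ x → x , id
  }

-- Shifted copies and padding

-- Filling words or multisets over the image of shift up to a fixed size with copies of pad
-- still reflects the order, since no shifted point lies below pad.
record Shift (A : QO ℓ) : Set ℓ where
  field
    pad      : ∣ A ∣
    shift    : ∣ A ∣ → ∣ A ∣
    monotone : ∀ {x y} → x ≤[ A ] y → shift x ≤[ A ] shift y
    reflects : ∀ {x y} → shift x ≤[ A ] shift y → x ≤[ A ] y
    avoids   : ∀ {x} → ¬ shift x ≤[ A ] pad

module _ {A : QO ℓ} where
  private
    _≲_ = Below A

    -- Serves to cancel a common head `y`. An embedding of `y ∷ xs` into `y ∷ ys` may send an entry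
    -- of `xs` to the head of the target; that entry is rerouted to the place `j₀` taken by the head
    -- of the source, whose value is above `y` and so above the entry.
    refill : ∀ {n} (j₀ j : Fin (suc n)) → j ≢ j₀ → Fin n
    refill zero    zero    j≢j₀ = ⊥-elim (j≢j₀ refl)
    refill (suc k) zero    _    = k
    refill _       (suc k) _    = k

    refill-injective : ∀ {n} (j₀ i j : Fin (suc n)) (i≢ : i ≢ j₀) (j≢ : j ≢ j₀) →
      refill j₀ i i≢ ≡ refill j₀ j j≢ → i ≡ j
    refill-injective zero    zero    _       i≢ _  _    = ⊥-elim (i≢ refl)
    refill-injective zero    _       zero    _  j≢ _    = ⊥-elim (j≢ refl)
    refill-injective (suc k) zero    zero    _  _  _    = refl
    refill-injective (suc k) zero    (suc j) _  j≢ refl = ⊥-elim (j≢ refl)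
    refill-injective (suc k) (suc i) zero    i≢ _  refl = ⊥-elim (i≢ refl)
    refill-injective zero    (suc i) (suc j) _  _  refl = refl
    refill-injective (suc k) (suc i) (suc j) _  _  refl = refl

    refill-above : ∀ {x y ys} (j₀ j : Fin (suc (length ys))) (j≢ : j ≢ j₀) →
      y ≲ lookup (y ∷ ys) j₀ → x ≲ lookup (y ∷ ys) j → x ≲ lookup ys (refill j₀ j j≢)
    refill-above zero    zero    j≢ _ _   = ⊥-elim (j≢ refl)
    refill-above (suc k) zero    _  y≲ x≲ = Preorder.trans A x≲ y≲
    refill-above zero    (suc k) _  _  x≲ = x≲
    refill-above (suc _) (suc k) _  _  x≲ = x≲

  multiset-∷⁻ : ∀ {y xs ys} → y ∷ xs ≤[ Multisets A ] y ∷ ys → xs ≤[ Multisets A ] ys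
  multiset-∷⁻ (f , q) =
    mk↣ (λ {i} {j} eq → Fin.suc-injective (Injection.injective f
      (refill-injective (to zero) (to (suc i)) (to (suc j)) (≢to0 i) (≢to0 j) eq))) ,
    λ i → refill-above (to zero) (to (suc i)) (≢to0 i) (q zero) (q (suc i))
    where
    open Injection f using (to)
    ≢to0 : ∀ i → to (suc i) ≢ to zero
    ≢to0 i eq with () ← Injection.injective f eq

  multiset-∷⁺ : ∀ {y xs ys} → xs ≤[ Multisets A ] ys → y ∷ xs ≤[ Multisets A ] y ∷ ys
  multiset-∷⁺ (f , q) =
    mk↣ (Fin.lift-injective (Injection.to f) (Injection.injective f) 1) ,
    λ { zero → Preorder.refl A ; (suc i) → q i }

-- Ordinals are shifted by one, away from 0. A sum is shifted only in the summand of `pad`, the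
-- other one being incomparable to it. Words and multisets get an extra entry, which keeps them off
-- the empty one and can be cancelled. For finite sets the extra element does the same for the empty
-- set, but it could absorb other elements, so these are shifted out of its reach.
shiftOf : (E : Expr ℓ) → Shift ⟦ E ⟧
shiftOf (ordinal α _ mi) = record
  { pad      = 0ᵒ , multIndecomposable-positive mi
  ; shift    = λ (β , β<α) → sucᵒ β , multIndecomposable-limit mi β β<α
  ; monotone = λ (lift β≤γ) → lift λ _ → _ , β≤γ
  ; reflects = λ (lift q) → lift (proj₂ (q _))
  ; avoids   = λ (lift q) → lower (proj₁ (q _))
  }
shiftOf (E₁ ⊔ᵉ E₂) = record
  { pad      = inj₁ pad
  ; shift    = Sum.map shift id
  ; monotone = λ { (inj₁ q) → inj₁ (monotone q) ; (inj₂ q) → inj₂ q }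
  ; reflects = λ { {inj₁ _} {inj₁ _} (inj₁ q) → inj₁ (reflects q) ; {inj₂ _} {inj₂ _} (inj₂ q) → inj₂ q }
  ; avoids   = λ { {inj₁ _} (inj₁ q) → avoids q }
  }
  where open Shift (shiftOf E₁)
shiftOf (E₁ ×ᵉ E₂) = record
  { pad      = S₁.pad , S₂.pad
  ; shift    = λ (x , y) → S₁.shift x , S₂.shift y
  ; monotone = λ (q , q′) → S₁.monotone q , S₂.monotone q′
  ; reflects = λ (q , q′) → S₁.reflects q , S₂.reflects q′
  ; avoids   = λ (q , _) → S₁.avoids q
  }
  where
  module S₁ = Shift (shiftOf E₁)
  module S₂ = Shift (shiftOf E₂)
shiftOf (words E) = record
  { pad      = []
  ; shift    = pad ∷_
  ; monotone = Preorder.refl ⟦ E ⟧ ∷_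
  ; reflects = Sublist.∷⁻
  ; avoids   = λ ()
  }
  where open Shift (shiftOf E)
shiftOf (M⋄ E) = record
  { pad      = []
  ; shift    = pad ∷_
  ; monotone = multiset-∷⁺ {A = ⟦ E ⟧}
  ; reflects = multiset-∷⁻ {A = ⟦ E ⟧}
  ; avoids   = λ (f , _) → Fin.¬Fin0 (Injection.to f zero)
  }
  where open Shift (shiftOf E)
shiftOf (Pf E) = record
  { pad      = []
  ; shift    = λ S → pad ∷ map shift S
  ; monotone = λ q → here (Preorder.refl ⟦ E ⟧) ∷
      All.map there (All.map⁺ (All.map (Any.map⁺ ∘ Any.map monotone) q))
  ; reflects = λ { (_ ∷ q) → All.map (λ r → Any.map reflects (Any.map⁻ (Any.tail avoids r))) (All.map⁻ q) }
  ; avoids   = λ { (() ∷ _) }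
  }
  where open Shift (shiftOf E)

Generated : (A : QO ℓ) → List ∣ A ∣ → ∣ A ∣ → Set ℓ
Generated A S x = Any (λ s → x ≤[ A ] s) S

-- `concat S` does double duty: its members bound the entries of everything below `S`, and its
-- length is a generous bound on the sizes.
≤-length-concat : {A : Set a} (S : List (List A)) {k : ℕ} →
  Any (λ s → k ≤ length s) S → k ≤ length (concat S)
≤-length-concat (s ∷ S) (here k≤)  rewrite length-++ s {concat S} = ℕ.≤-trans k≤ (ℕ.m≤m+n _ _)
≤-length-concat (s ∷ S) (there k≤) rewrite length-++ s {concat S} =
  ℕ.≤-trans (≤-length-concat S k≤) (ℕ.m≤n+m _ (length s))

-- `L` ranges over subword, multiset and Hoare embedding, which all imply the Hoare order.
generated-concat : (A : QO ℓ) (L : Rel (List ∣ A ∣) ℓ) →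
  (∀ {xs ys} → L xs ys → xs ≤[ FiniteSubsets A ] ys) →
  ∀ S xs → Any (L xs) S → All (Generated A (concat S)) xs
generated-concat A L hoare S xs xs∈↓S = All.tabulate λ x∈xs →
  Any.concat⁺ (Any.map (λ xs≤s → All.lookup (hoare xs≤s) x∈xs) xs∈↓S)

module Padding {A : Set a} {B : Set b} (f : A → B) (q : B) where

  -- Lists longer than `n` are cut off. This makes the map total and does no harm, as the order is
  -- reflected only from lists of length at most `n`.
  padded : ∀ {n} → List A → Fin n → B
  padded []       _       = q
  padded (x ∷ xs) zero    = f x
  padded (x ∷ xs) (suc i) = padded xs i

  padded-inside : ∀ {n} xs (i : Fin (length xs)) (j : Fin n) →
    toℕ j ≡ toℕ i → padded xs j ≡ f (lookup xs i)
  padded-inside (x ∷ xs) zero    zero    _  = refl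
  padded-inside (x ∷ xs) (suc i) (suc j) eq = padded-inside xs i j (ℕ.suc-injective eq)

  padded-view : ∀ {n} xs (j : Fin n) →
    (∃[ i ] toℕ j ≡ toℕ {length xs} i × padded xs j ≡ f (lookup xs i)) ⊎ padded xs j ≡ q
  padded-view []       j       = inj₂ refl
  padded-view (x ∷ xs) zero    = inj₁ (zero , refl , refl)
  padded-view (x ∷ xs) (suc j) with padded-view xs j
  ... | inj₁ (i , eq , eq′) = inj₁ (suc i , cong suc eq , eq′)
  ... | inj₂ eq             = inj₂ eq

  module _ (_≲_ : Rel A p) (_≲′_ : Rel B r) (D : A → Set c)
           (reflects : ∀ {x y} → D x → D y → f x ≲′ f y → x ≲ y)
           (avoids : ∀ {x} → D x → ¬ f x ≲′ q) where

    padded-sublist : ∀ n xs ys → length xs ≤ n → All D xs → All D ys →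
      (∀ i → padded {n} xs i ≲′ padded ys i) → Sublist _≲_ xs ys
    padded-sublist n       []       ys       _         _          _          _ = minimum ys
    padded-sublist (suc n) (x ∷ xs) []       _         (dx ∷ _)   _          q = ⊥-elim (avoids dx (q zero))
    padded-sublist (suc n) (x ∷ xs) (y ∷ ys) (s≤s len) (dx ∷ dxs) (dy ∷ dys) q =
      reflects dx dy (q zero) ∷ padded-sublist n xs ys len dxs dys (q ∘ suc)

    padded-match : ∀ n xs ys → length xs ≤ n → All D xs → All D ys →
      Match _≲′_ (padded {n} xs) (padded {n} ys) → Match _≲_ (lookup xs) (lookup ys)
    padded-match n xs ys len dxs dys (match σ r) =
      match (mk↣ (λ {i} {j} → target-injective i j)) (proj₂ ∘ proj₂ ∘ image)
      where
      open Injection σ using (to; injective)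

      -- Padding of `xs` may be matched with anything, so only the slots of genuine entries are
      -- followed; by `avoids` these cannot land in the padding of `ys`.
      image : ∀ i → ∃[ k ] toℕ (to (inject≤ i len)) ≡ toℕ k × lookup xs i ≲ lookup ys k
      image i with padded-view ys (to (inject≤ i len))
                 | subst (_≲′ padded ys (to (inject≤ i len)))
                     (padded-inside xs i (inject≤ i len) (Fin.toℕ-inject≤ i len)) (r (inject≤ i len))
      ... | inj₁ (k , eq , eq′) | fx≲ = k , eq ,
        reflects (All.lookup dxs (∈-lookup i)) (All.lookup dys (∈-lookup k)) (subst (f (lookup xs i) ≲′_) eq′ fx≲)
      ... | inj₂ eq             | fx≲ =
        ⊥-elim (avoids (All.lookup dxs (∈-lookup i)) (subst (f (lookup xs i) ≲′_) eq fx≲))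

      target-injective : ∀ i j → proj₁ (image i) ≡ proj₁ (image j) → i ≡ j
      target-injective i j eq = Fin.inject≤-injective len len i j
        (injective (Fin.toℕ-injective
          (trans (proj₁ (proj₂ (image i))) (trans (cong toℕ eq) (sym (proj₁ (proj₂ (image j))))))))

-- Coding ideals by points

-- Codes are the points of E that stand for ideals of A: e ↦ { x | x ∈ᶜ e }
-- embeds them into E, and every residual of A is a finite union of coded ideals.  Inclusion
-- of e in a union of codes implies that e lies below one of them, because of the generic
-- points, which avoid every given code that is not above e.
record Completion (A E : QO ℓ) : Set (lsuc ℓ) where
  infix 4 _∈ᶜ_
  field
    Code      : Set ℓ
    point     : Code → ∣ E ∣
    _∈ᶜ_      : ∣ A ∣ → Code → Set ℓ
    ∈-up      : ∀ {x e f} → x ∈ᶜ e → point e ≤[ E ] point f → x ∈ᶜ f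
    ∈-down    : ∀ {x y e} → x ≤[ A ] y → y ∈ᶜ e → x ∈ᶜ e
    generic   : ∀ e K → ∃[ x ] x ∈ᶜ e × All (λ f → x ∈ᶜ f → point e ≤[ E ] point f) K
    top       : List Code
    top-all   : ∀ x → Any (x ∈ᶜ_) top
    residual  : Code → ∣ A ∣ → List Code
    residual⁺ : ∀ {e x y} → y ∈ᶜ e → ¬ x ≤[ A ] y → Any (y ∈ᶜ_) (residual e x)
    residual⁻ : ∀ {e x y} → Any (y ∈ᶜ_) (residual e x) → y ∈ᶜ e × ¬ x ≤[ A ] y

  residual* : List Code → ∣ A ∣ → List Code
  residual* K x = concatMap (λ e → residual e x) K

  residual*⁺ : ∀ {K x y} → Any (y ∈ᶜ_) K → ¬ x ≤[ A ] y → Any (y ∈ᶜ_) (residual* K x)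
  residual*⁺ y∈K x≰y = Any.concatMap⁺ _ (Any.map (λ y∈e → residual⁺ y∈e x≰y) y∈K)

  residual*⁻ : ∀ {K x y} → Any (y ∈ᶜ_) (residual* K x) → Any (y ∈ᶜ_) K × ¬ x ≤[ A ] y
  residual*⁻ {K} y∈ =
    let e , e∈K , y∈res = find (Any.concatMap⁻ _ {xs = K} y∈)
        y∈e , x≰y       = residual⁻ y∈res
    in  lose e∈K y∈e , x≰y

  residuals : List Code → List ∣ A ∣ → List Code
  residuals K []       = K
  residuals K (x ∷ xs) = residual* (residuals K xs) x

  residuals⁺ : ∀ {K xs y} → Any (y ∈ᶜ_) K → All (λ x → ¬ x ≤[ A ] y) xs → Any (y ∈ᶜ_) (residuals K xs)
  residuals⁺ y∈K []         = y∈K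
  residuals⁺ y∈K (x≰y ∷ ys) = residual*⁺ (residuals⁺ y∈K ys) x≰y

  residuals⁻ : ∀ {K xs y} → Any (y ∈ᶜ_) (residuals K xs) → Any (y ∈ᶜ_) K × All (λ x → ¬ x ≤[ A ] y) xs
  residuals⁻ {xs = []}     y∈ = y∈ , []
  residuals⁻ {K} {x ∷ xs} y∈ =
    let y∈res , x≰y = residual*⁻ {residuals K xs} y∈
        y∈K , xs≰y  = residuals⁻ {xs = xs} y∈res
    in  y∈K , x≰y ∷ xs≰y

module _ {A B E F : QO ℓ} (f : ∣ B ∣ → ∣ A ∣) (g : ∣ E ∣ → ∣ F ∣)
  (f⁺ : ∀ {x y} → x ≤[ B ] y → f x ≤[ A ] f y)
  (f⁻ : ∀ {x y} → f x ≤[ A ] f y → x ≤[ B ] y)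
  (f-onto : ∀ x → ∃[ z ] f z ≤[ A ] x × x ≤[ A ] f z)
  (g⁺ : ∀ {x y} → x ≤[ E ] y → g x ≤[ F ] g y)
  (g⁻ : ∀ {x y} → g x ≤[ F ] g y → x ≤[ E ] y)
  (C : Completion A E) where
  open Completion C

  -- Surjectivity of `f` up to equivalence brings the generic points back to `B`; the remaining
  -- fields follow from `f` and `g` being order embeddings.
  transport : Completion B F
  transport = record
    { Code      = Code
    ; point     = g ∘ point
    ; _∈ᶜ_      = λ x e → f x ∈ᶜ e
    ; ∈-up      = λ x∈e e≤f → ∈-up x∈e (g⁻ e≤f)
    ; ∈-down    = ∈-down ∘ f⁺
    ; generic   = λ e K →
        let x , x∈e , above = generic e K
            z , fz≤x , x≤fz = f-onto x
        in  z , ∈-down fz≤x x∈e , All.map (λ q fz∈ → g⁺ (q (∈-down x≤fz fz∈))) above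
    ; top       = top
    ; top-all   = top-all ∘ f
    ; residual  = λ e x → residual e (f x)
    ; residual⁺ = λ y∈e x≰y → residual⁺ y∈e (x≰y ∘ f⁻)
    ; residual⁻ = λ y∈ → let y∈e , fx≰fy = residual⁻ y∈ in y∈e , fx≰fy ∘ f⁺
    }

≅-completion : {A B E : QO ℓ} → B ≅ A → Completion A E → Completion B E
≅-completion {A = A} {B} {E} (f , iso) = transport {A = A} {B} {E} {E} f id mono cancel
  (λ x → let z , onto = surjective x
             fz≤x , x≤fz = onto {z} (Preorder.refl B , Preorder.refl B) in z , fz≤x , x≤fz)
  id id
  where open IsOrderIsomorphism iso

-- Enumeration and inversion of maps between finite index sets

functions : {A : Set a} (n : ℕ) → List A → List (Fin n → A)
functions zero    L = (λ ()) ∷ []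
functions (suc n) L = concatMap (λ x → map (x Vector.∷_) (functions n L)) L

-- Membership is expressed through a predicate on the values: without function extensionality a
-- given function need not be equal to the enumerated one.
functions⁺ : {A : Set a} {n : ℕ} {P : Fin n → A → Set p} {L : List A} →
  (∀ i → Any (P i) L) → Any (λ v → ∀ i → P i (v i)) (functions n L)
functions⁺ {n = zero}  _ = here λ ()
functions⁺ {n = suc n} q = Any.concatMap⁺ _ (Any.map
  (λ Px → Any.map⁺ (Any.map (λ Pv → λ { zero → Px ; (suc i) → Pv i }) (functions⁺ (q ∘ suc)))) (q zero))

-- Pigeonhole: if `j` were missed, punching it out would inject `Fin (suc n)` into `Fin n`.
injection-onto : ∀ {n} (σ : Fin n ↣ Fin n) j → ∃[ i ] Injection.to σ i ≡ j
injection-onto {suc n} σ j with Fin.any? (λ i → Injection.to σ i Fin.≟ j)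
... | yes hit  = hit
... | no  miss = ⊥-elim (ℕ.1+n≰n (Fin.injective⇒≤ {f = λ i → punchOut (missed i)}
                   (λ {i} {i′} eq → Injection.injective σ (Fin.punchOut-injective (missed i) (missed i′) eq))))
  where
  missed : ∀ i → j ≢ Injection.to σ i
  missed i j≡σi = miss (i , sym j≡σi)

inverse : ∀ {n} → Fin n ↣ Fin n → Fin n ↣ Fin n
inverse σ = mk↣ {to = proj₁ ∘ injection-onto σ} λ {i} {j} eq →
  trans (sym (proj₂ (injection-onto σ i))) (trans (cong (Injection.to σ) eq) (proj₂ (injection-onto σ j)))

module _ {A : Set a} {B : Set b} {R : REL A B r} {n : ℕ} {u : Fin n → A} {v : Fin n → B} where

  -- Between families of one size an embedding is a permutation. Moving it to the left-hand family
  -- turns multiset embedding into the pointwise order, where the residuals of powers are available.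
  match⇒reindexed : Match R u v → ∃[ τ ] ∀ k → R (u (Injection.to {To = setoid (Fin n)} τ k)) (v k)
  match⇒reindexed (match σ q) = inverse σ , λ k →
    subst (λ j → R (u (proj₁ (injection-onto σ k))) (v j)) (proj₂ (injection-onto σ k)) (q _)

  reindexed⇒match : (τ : Fin n ↣ Fin n) → (∀ k → R (u (Injection.to τ k)) (v k)) → Match R u v
  reindexed⇒match τ q = match (inverse τ) λ i →
    subst (λ j → R (u j) (v (proj₁ (injection-onto τ i)))) (proj₂ (injection-onto τ i)) (q _)

-- The multisets of exactly `n` elements, with the size built into the type instead of carried as an
-- equation on lengths.
Families : ℕ → QO ℓ → QO ℓ
Families n A = quasiOrder {A = Fin n → ∣ A ∣} (Match (Below A))
  (match (↣-id _) λ _ → Preorder.refl A) (match-trans (Preorder.trans A))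

-- Ranks

≤ᵒ-raise : (α : Ord ℓ) → α ≤ᵒ raise α
≤ᵒ-raise (sup⁺ I f) i = lift i , ≤ᵒ-raise (f i)

raise-≤ᵒ : (α : Ord ℓ) → raise α ≤ᵒ α
raise-≤ᵒ (sup⁺ I f) (lift i) = i , raise-≤ᵒ (f i)

module _ {T : Set a} {U : Set b} {_◃_ : Rel T a} {_▹_ : Rel U b} (Sim : T → U → Set p)
  (step : ∀ {t t′ u} → Sim t u → t′ ◃ t → ∃[ u′ ] u′ ▹ u × Sim t′ u′) where

  rank-simulation : ∀ {t u} (p : Acc _◃_ t) (q : Acc _▹_ u) → Sim t u → rank p ≤ᵒ rank q
  rank-simulation (acc rs) (acc qs) sim (t′ , t′◃t) =
    let u′ , u′▹u , sim′ = step sim t′◃t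
    in  (u′ , u′▹u) , rank-simulation (rs t′◃t) (qs u′▹u) sim′

module _ {T : Set a} {_◃_ : Rel T a} where

  rank-upper : ∀ {s} (α : Ord b) (p : Acc _◃_ s) →
    (∀ {t} (q : Acc _◃_ t) → t ◃ s → rank q <ᵒ α) → rank p ≤ᵒ α
  rank-upper α (acc rs) below (t , t◃s) = below (rs t◃s) t◃s

  rank-lower : ∀ {s t} (α : Ord b) (p : Acc _◃_ s) → t ◃ s →
    ((q : Acc _◃_ t) → α ≤ᵒ rank q) → α <ᵒ rank p
  rank-lower α (acc rs) t◃s above = (_ , t◃s) , above (rs t◃s)

-- Classical logic and comparability of ordinals

module Classical (em : ∀ {ℓ} → ExcludedMiddle ℓ) where

  dne : {P : Set p} → ¬ ¬ P → P
  dne = decidable-stable em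

  ¬∀⇒∃¬ : {A : Set a} {P : A → Set p} → ¬ (∀ x → P x) → ∃[ x ] ¬ P x
  ¬∀⇒∃¬ ¬all = dne λ ¬ex → ¬all λ x → dne λ ¬Px → ¬ex (x , ¬Px)

  -- If some `f i` is not below `β`, it is above no child of `β` in the weak sense `f i ≤ᵒ g j`;
  -- comparing it recursively with each `g j` leaves `g j <ᵒ f i`, that is, `β ≤ᵒ f i`.
  ≤ᵒ-or->ᵒ : (α : Ord a) (β : Ord b) → α ≤ᵒ β ⊎ β <ᵒ α
  ≤ᵒ-or->ᵒ (sup⁺ I f) (sup⁺ J g) with em {P = ∀ i → f i <ᵒ sup⁺ J g}
  ... | yes all<  = inj₁ all<
  ... | no  ¬all< =
    let i , fi≮β = ¬∀⇒∃¬ ¬all<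
    in  inj₂ (i , λ j → below (≤ᵒ-or->ᵒ (f i) (g j)) (λ fi≤gj → fi≮β (j , fi≤gj)))
    where
    below : ∀ {i j} → f i ≤ᵒ g j ⊎ g j <ᵒ f i → ¬ f i ≤ᵒ g j → g j <ᵒ f i
    below (inj₁ q) ¬q = ⊥-elim (¬q q)
    below (inj₂ q) _  = q

  -- A descent from `x 0` to `x 1` replaces the bound `α` by one of its children; the recursion on
  -- this separate bound is structural.
  nondecreasing-step : (α : Ord ℓ) (x : ℕ → Ord ℓ) → x 0 ≤ᵒ α → ∃[ i ] x i ≤ᵒ x (suc i)
  nondecreasing-step (sup⁺ I f) x x₀≤α with ≤ᵒ-or->ᵒ (x 0) (x 1)
  ... | inj₁ x₀≤x₁ = 0 , x₀≤x₁
  ... | inj₂ x₁<x₀ =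
    let k , x₁≤fk = <-≤-transᵒ (x 1) (x 0) (sup⁺ I f) x₁<x₀ x₀≤α
        i , q     = nondecreasing-step (f k) (x ∘ suc) x₁≤fk
    in  suc i , q

  wqo-segment : (α : Ord ℓ) → IsWQO (segment α)
  wqo-segment α x =
    let i , xᵢ≤xᵢ₊₁ = nondecreasing-step (proj₁ (x 0)) (proj₁ ∘ x) (≤ᵒ-refl _)
    in  i , suc i , ℕ.≤-refl , lift xᵢ≤xᵢ₊₁

  -- Well-quasi-orders

  record Subsequence {A : Set a} (T : Rel A ℓ) (x : ℕ → A) : Set ℓ where
    field
      index      : ℕ → ℕ
      index-mono : ∀ {i j} → i < j → index i < index j
      related    : ∀ {i j} → i < j → T (x (index i)) (x (index j))

  module _ {P : ℕ → Set p} where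

    EventuallyNot InfinitelyOften : Set p
    EventuallyNot   = ∃[ N ] ∀ n → N ≤ n → ¬ P n
    InfinitelyOften = ∀ N → ∃[ n ] N ≤ n × P n

    eventually-or-infinitely : EventuallyNot ⊎ InfinitelyOften
    eventually-or-infinitely with em {P = EventuallyNot}
    ... | yes q = inj₁ q
    ... | no ¬q = inj₂ λ N → dne λ ¬later → ¬q (N , λ n N≤n Pn → ¬later (n , N≤n , Pn))

    module Enumerate (inf : InfinitelyOften) where
      enum : ℕ → ℕ
      enum zero    = proj₁ (inf 0)
      enum (suc k) = proj₁ (inf (suc (enum k)))

      enum-holds : ∀ k → P (enum k)
      enum-holds zero    = proj₂ (proj₂ (inf 0))
      enum-holds (suc k) = proj₂ (proj₂ (inf (suc (enum k))))

      enum-mono : ∀ {i j} → i < j → enum i < enum j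
      enum-mono = chain ℕ.<-trans λ k → proj₁ (proj₂ (inf (suc (enum k))))

  module _ (A : QO ℓ) (wqo : IsWQO A) (x : ℕ → ∣ A ∣) where

    private
      Terminal : ℕ → Set ℓ
      Terminal n = ∀ m → n < m → ¬ x n ≤[ A ] x m

      -- Infinitely many terminal indices would enumerate a bad sequence. Past the last one, every
      -- term has a later term above it, and an ascending subsequence can be chosen greedily.
      nonTerminal-eventually : ∃[ N ] ∀ n → N ≤ n → ¬ Terminal n
      nonTerminal-eventually with eventually-or-infinitely {P = Terminal}
      ... | inj₁ q   = q
      ... | inj₂ inf =
        let open Enumerate inf
            i , j , i<j , xᵢ≤xⱼ = wqo (x ∘ enum)
        in  ⊥-elim (enum-holds i (enum j) (enum-mono i<j) xᵢ≤xⱼ)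

      N : ℕ
      N = proj₁ nonTerminal-eventually

      successor : ∀ n → N ≤ n → ∃[ m ] n < m × x n ≤[ A ] x m
      successor n N≤n = dne λ ¬q →
        proj₂ nonTerminal-eventually n N≤n λ m n<m xₙ≤xₘ → ¬q (m , n<m , xₙ≤xₘ)

      state : ℕ → ∃[ n ] N ≤ n
      state zero    = N , ℕ.≤-refl
      state (suc k) =
        let n , N≤n     = state k
            m , n<m , _ = successor n N≤n
        in  m , ℕ.≤-trans N≤n (ℕ.<⇒≤ n<m)

    ascending-subsequence : Subsequence (Below A) x
    ascending-subsequence = record
      { index      = proj₁ ∘ state
      ; index-mono = chain ℕ.<-trans λ k → proj₁ (proj₂ (next k))
      ; related    = chain {T = λ i j → x (proj₁ (state i)) ≤[ A ] x (proj₁ (state j))}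
                       (Preorder.trans A) λ k → proj₂ (proj₂ (next k))
      }
      where
      next : ∀ k → ∃[ m ] proj₁ (state k) < m × x (proj₁ (state k)) ≤[ A ] x m
      next k = successor (proj₁ (state k)) (proj₂ (state k))

  wqo-⊗ : (A B : QO ℓ) → IsWQO A → IsWQO B → IsWQO (A ⊗ B)
  wqo-⊗ A B wqoA wqoB x =
    let open Subsequence (ascending-subsequence A wqoA (proj₁ ∘ x))
        i , j , i<j , q = wqoB (proj₂ ∘ x ∘ index)
    in  index i , index j , index-mono i<j , related i<j , q

  wqo-⊔ : (A B : QO ℓ) → IsWQO A → IsWQO B → IsWQO (A ⊔ B)
  wqo-⊔ A B wqoA wqoB x
    with eventually-or-infinitely {P = λ n → ∃[ y ] x n ≡ inj₁ y}
  ... | inj₂ inf =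
    let open Enumerate inf
        i , j , i<j , q = wqoA (proj₁ ∘ enum-holds)
    in  enum i , enum j , enum-mono i<j ,
        subst₂ (Below (A ⊔ B)) (sym (proj₂ (enum-holds i))) (sym (proj₂ (enum-holds j))) (inj₁ q)
  ... | inj₁ (N , ¬left) =
    let i , j , i<j , q = wqoB (proj₁ ∘ right)
    in  N + i , N + j , ℕ.+-monoʳ-< N i<j ,
        subst₂ (Below (A ⊔ B)) (sym (proj₂ (right i))) (sym (proj₂ (right j))) (inj₂ q)
    where
    right : ∀ k → ∃[ y ] x (N + k) ≡ inj₂ y
    right k with x (N + k) in eq
    ... | inj₁ y = ⊥-elim (¬left (N + k) (ℕ.m≤m+n N k) (y , eq))
    ... | inj₂ y = y , refl

  -- Higman's lemma, by Nash-Williams' minimal bad sequence.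
  module _ (A : QO ℓ) (wqo : IsWQO A) where

    private
      W = Words A

      Bad : (ℕ → ∣ W ∣) → Set ℓ
      Bad g = ∀ {i j} → i < j → ¬ g i ≤[ W ] g j

      AgreeBelow : ℕ → (g g′ : ℕ → ∣ W ∣) → Set ℓ
      AgreeBelow n g g′ = ∀ {k} → k < n → g k ≡ g′ k

      MinimalAt : ℕ → (ℕ → ∣ W ∣) → Set ℓ
      MinimalAt n g = ∀ g′ → Bad g′ → AgreeBelow n g g′ → length (g n) ≤ length (g′ n)

      minimise : ∀ n g → Bad g → Acc _<_ (length (g n)) →
        ∃[ g′ ] Bad g′ × AgreeBelow n g g′ × MinimalAt n g′
      minimise n g bad (acc smaller)
        with em {P = ∃[ g′ ] Bad g′ × AgreeBelow n g g′ × length (g′ n) < length (g n)}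
      ... | no ¬q = g , bad , (λ _ → refl) ,
        λ g′ bad′ agree → ℕ.≮⇒≥ λ g′<g → ¬q (g′ , bad′ , agree , g′<g)
      ... | yes (g′ , bad′ , agree , g′<g) =
        let g″ , bad″ , agree′ , min = minimise n g′ bad′ (smaller g′<g)
        in  g″ , bad″ , (λ k<n → trans (agree k<n) (agree′ k<n)) , min

      module MinimalBad (g : ℕ → ∣ W ∣) (g-bad : Bad g) where

        -- `approx n` has been minimised at the positions before `n`; `choice n` minimises it at `n`
        -- and keeps those. The minimal bad sequence `m` is the diagonal.
        approx : ℕ → ∃ Bad
        choice : ∀ n → ∃[ g′ ] Bad g′ × AgreeBelow n (proj₁ (approx n)) g′ × MinimalAt n g′
        approx zero    = g , g-bad
        approx (suc n) = let g′ , bad , _ = choice n in g′ , bad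
        choice n       = let g′ , bad = approx n in minimise n g′ bad (<-wellFounded _)

        stage : ℕ → ℕ → ∣ W ∣
        stage n = proj₁ (choice n)

        m : ℕ → ∣ W ∣
        m n = stage n n

        stage-agrees : ∀ n {k} → k ≤ n → stage n k ≡ m k
        stage-agrees n {k} k≤n with ℕ.m≤n⇒m<n∨m≡n k≤n
        stage-agrees n       k≤n | inj₂ refl = refl
        stage-agrees (suc n) _   | inj₁ k<n  =
          trans (sym (proj₁ (proj₂ (proj₂ (choice (suc n)))) k<n)) (stage-agrees n (ℕ.≤-pred k<n))

        m-bad : Bad m
        m-bad {i} {j} i<j mᵢ≤mⱼ = proj₁ (proj₂ (choice j)) i<j
          (subst (λ w → w ≤[ W ] m j) (sym (stage-agrees j (ℕ.<⇒≤ i<j))) mᵢ≤mⱼ)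

        m-minimal : ∀ n g′ → Bad g′ → AgreeBelow n m g′ → length (m n) ≤ length (g′ n)
        m-minimal n g′ bad′ agree = proj₂ (proj₂ (proj₂ (choice n))) g′ bad′
          λ k<n → trans (stage-agrees n (ℕ.<⇒≤ k<n)) (agree k<n)

        uncons : ∀ n → ∃₂ λ x w → m n ≡ x ∷ w
        uncons n with m n in eq
        ... | x ∷ w = x , w , refl
        ... | []    = ⊥-elim (m-bad (ℕ.n<1+n n)
          (subst (λ w → w ≤[ W ] m (suc n)) (sym eq) (minimum (m (suc n)))))

        head : ℕ → ∣ A ∣
        head = proj₁ ∘ uncons

        tail : ℕ → ∣ W ∣
        tail = proj₁ ∘ proj₂ ∘ uncons

        m≡ : ∀ n → m n ≡ head n ∷ tail n
        m≡ = proj₂ ∘ proj₂ ∘ uncons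

        open Subsequence (ascending-subsequence A wqo head)

        -- Nash-Williams' competitor to `m`: from the position `index 0` on, the words are the tails
        -- along the subsequence with ascending heads. It agrees with `m` before that position and
        -- is shorter there by one letter.
        shorter : ℕ → ∣ W ∣
        shorter k with k ℕ.<? index 0
        ... | yes _ = m k
        ... | no  _ = tail (index (k ∸ index 0))

        index≥ : ∀ k → index 0 ≤ index k
        index≥ zero    = ℕ.≤-refl
        index≥ (suc k) = ℕ.<⇒≤ (index-mono {0} {suc k} z<s)

        shorter-bad : Bad shorter
        shorter-bad {i} {j} i<j with i ℕ.<? index 0 | j ℕ.<? index 0
        ... | yes _   | yes _   = m-bad i<j
        ... | yes i<s | no  _   = λ mᵢ≤tail → m-bad (ℕ.<-≤-trans i<s (index≥ (j ∸ index 0)))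
          (subst (λ w → m i ≤[ W ] w) (sym (m≡ (index (j ∸ index 0)))) (_ ∷ʳ mᵢ≤tail))
        ... | no  i≮s | yes j<s = λ _ → i≮s (ℕ.<-trans i<j j<s)
        ... | no  i≮s | no  _   = λ tail≤tail → m-bad (index-mono i<j′)
          (subst₂ (Below W) (sym (m≡ (index (i ∸ index 0)))) (sym (m≡ (index (j ∸ index 0)))) (related i<j′ ∷ tail≤tail))
          where
          i<j′ : i ∸ index 0 < j ∸ index 0
          i<j′ = ℕ.∸-monoˡ-< i<j (ℕ.≮⇒≥ i≮s)

        shorter-below : AgreeBelow (index 0) m shorter
        shorter-below {k} k<s with k ℕ.<? index 0
        ... | yes _   = refl
        ... | no  k≮s = ⊥-elim (k≮s k<s)

        shorter-at : shorter (index 0) ≡ tail (index 0)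
        shorter-at with index 0 ℕ.<? index 0
        ... | yes s<s = ⊥-elim (ℕ.<-irrefl refl s<s)
        ... | no  _   = cong (tail ∘ index) (ℕ.n∸n≡0 (index 0))

        not-minimal : ⊥
        not-minimal = ℕ.<-irrefl refl
          (subst₂ _≤_ (cong length (m≡ (index 0))) (cong length shorter-at)
            (m-minimal (index 0) shorter shorter-bad shorter-below))

    wqo-words : IsWQO (Words A)
    wqo-words g = dne λ ¬good → MinimalBad.not-minimal g λ i<j gᵢ≤gⱼ → ¬good (_ , _ , i<j , gᵢ≤gⱼ)

  module _ (A : QO ℓ) (wqo : IsWQO A) where

    -- Subword embedding implies multiset embedding and the Hoare order, and on words of equal
    -- length the pointwise order, so Higman's lemma covers all of these constructions.
    wqo-multisets : IsWQO (Multisets A)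
    wqo-multisets = wqo-reflect {A = Words A} {B = Multisets A} id
      (λ _ _ q → let match f r = sublist⇒match q in f , r) (wqo-words A wqo)

    wqo-multisetsOfSize : ∀ n → IsWQO (MultisetsOfSize n A)
    wqo-multisetsOfSize n =
      wqo-reflect {A = Multisets A} {B = MultisetsOfSize n A} proj₁ (λ _ _ → id) wqo-multisets

    wqo-finiteSubsets : IsWQO (FiniteSubsets A)
    wqo-finiteSubsets = wqo-reflect {A = Words A} {B = FiniteSubsets A} id
      (λ _ _ → sublist⇒hoare) (wqo-words A wqo)

    wqo-power : ∀ n → IsWQO (Power A n)
    wqo-power n = wqo-reflect {A = Words A} {B = Power A n} tabulate
      tabulate-sublist⁻ (wqo-words A wqo)

  wqo-⟦_⟧ : (E : Expr ℓ) → IsWQO ⟦ E ⟧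
  wqo-⟦ ordinal α _ _ ⟧ = wqo-segment α
  wqo-⟦ E₁ ⊔ᵉ E₂ ⟧      = wqo-⊔ ⟦ E₁ ⟧ ⟦ E₂ ⟧ wqo-⟦ E₁ ⟧ wqo-⟦ E₂ ⟧
  wqo-⟦ E₁ ×ᵉ E₂ ⟧      = wqo-⊗ ⟦ E₁ ⟧ ⟦ E₂ ⟧ wqo-⟦ E₁ ⟧ wqo-⟦ E₂ ⟧
  wqo-⟦ words E ⟧       = wqo-words ⟦ E ⟧ wqo-⟦ E ⟧
  wqo-⟦ M⋄ E ⟧          = wqo-multisets ⟦ E ⟧ wqo-⟦ E ⟧
  wqo-⟦ Pf E ⟧          = wqo-finiteSubsets ⟦ E ⟧ wqo-⟦ E ⟧

  -- Approximations of down-closures of finite sets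

  -- Reflecting the order suffices for carrying bad sequences over to `base`. `embed` is total, but
  -- its values matter only on the down-closure of `S`.
  record Approximant (E : Expr ℓ) (S : List ∣ ⟦ E ⟧ ∣) : Set (lsuc (lsuc ℓ)) where
    field
      base      : QO (lsuc ℓ)
      base-wqo  : IsWQO base
      base<E    : base <approx E
      embed     : ∣ ⟦ E ⟧ ∣ → ∣ base ∣
      reflects  : ∀ {x y} → Generated ⟦ E ⟧ S x → Generated ⟦ E ⟧ S y →
                  embed x ≤[ base ] embed y → x ≤[ ⟦ E ⟧ ] y

  module _ {α : Ord ℓ} (mi : MultIndecomposable α) where

    -- Positivity of `α′` gives `truncate` the default value 0; for empty `S` the bound is 1.
    strict-bound : (S : List ∣ segment α ∣) →
      ∃[ α′ ] α′ <ᵒ α × 0ᵒ {ℓ} <ᵒ α′ × All (λ s → proj₁ s <ᵒ α′) S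
    strict-bound [] = sucᵒ 0ᵒ ,
      multIndecomposable-limit mi 0ᵒ (multIndecomposable-positive mi) , <ᵒ-sucᵒ 0ᵒ , []
    strict-bound ((β , β<α) ∷ S) with strict-bound S
    ... | α′ , α′<α , 0<α′ , S<α′ with ≤ᵒ-or->ᵒ α′ β
    ...   | inj₂ β<α′ = α′ , α′<α , 0<α′ , β<α′ ∷ S<α′
    ...   | inj₁ α′≤β = sucᵒ β , multIndecomposable-limit mi β β<α ,
      (_ , 0≤ᵒ β) , <ᵒ-sucᵒ β ∷
      All.map (λ {s} s<α′ → _ , ≤ᵒ-trans (proj₁ s) α′ β (<ᵒ⇒≤ᵒ (proj₁ s) α′ s<α′) α′≤β) S<α′

    truncate : (α′ : Ord ℓ) → 0ᵒ {ℓ} <ᵒ α′ → ∣ segment α ∣ → ∣ segment α′ ∣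
    truncate α′ 0<α′ (β , _) with em {P = β <ᵒ α′}
    ... | yes β<α′ = β , β<α′
    ... | no  _    = 0ᵒ , 0<α′

    truncate-reflects : ∀ α′ 0<α′ x y → proj₁ x <ᵒ α′ → proj₁ y <ᵒ α′ →
      truncate α′ 0<α′ x ≤[ segment α′ ] truncate α′ 0<α′ y → x ≤[ segment α ] y
    truncate-reflects α′ 0<α′ (β , _) (γ , _) β<α′ γ<α′ q
      with em {P = β <ᵒ α′} | em {P = γ <ᵒ α′}
    ... | yes _  | yes _  = q
    ... | no β≮α′ | _     = ⊥-elim (β≮α′ β<α′)
    ... | _ | no γ≮α′     = ⊥-elim (γ≮α′ γ<α′)

  -- The approximant is taken for the shifted generators together with `pad`, so that its embedding
  -- also reflects comparisons between a shifted entry and the padding.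
  module Shifted (E : Expr ℓ) (S : List ∣ ⟦ E ⟧ ∣)
    (A : Approximant E (Shift.pad (shiftOf E) ∷ map (Shift.shift (shiftOf E)) S)) where
    open Shift (shiftOf E) renaming (reflects to shift-reflects)
    open Approximant A public renaming (reflects to embed-reflects)

    private
      shifted : ∀ {x} → Generated ⟦ E ⟧ S x → Generated ⟦ E ⟧ (pad ∷ map shift S) (shift x)
      shifted x∈ = there (Any.map⁺ (Any.map monotone x∈))

    reflects : ∀ {x y} → Generated ⟦ E ⟧ S x → Generated ⟦ E ⟧ S y →
      embed (shift x) ≤[ base ] embed (shift y) → x ≤[ ⟦ E ⟧ ] y
    reflects x∈ y∈ q = shift-reflects (embed-reflects (shifted x∈) (shifted y∈) q)

    avoids-pad : ∀ {x} → Generated ⟦ E ⟧ S x → ¬ embed (shift x) ≤[ base ] embed pad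
    avoids-pad x∈ q = avoids (embed-reflects (shifted x∈) (here (Preorder.refl ⟦ E ⟧)) q)

    open Padding (embed ∘ shift) (embed pad) public

  approximant : (E : Expr ℓ) (S : List ∣ ⟦ E ⟧ ∣) → Approximant E S
  approximant (ordinal α _ mi) S with strict-bound mi S
  ... | α′ , α′<α , 0<α′ , S<α′ = record
    { base     = segment α′
    ; base-wqo = wqo-segment α′
    ; base<E   = ordinal α′<α (≅-refl {A = segment α′})
    ; embed    = truncate mi α′ 0<α′
    ; reflects = λ {x} {y} x∈ y∈ → truncate-reflects mi α′ 0<α′ x y (bounded x x∈) (bounded y y∈)
    }
    where
    bounded : ∀ x → Generated (segment α) S x → proj₁ x <ᵒ α′
    bounded (β , _) x∈ =
      let (s , _) , s∈S , lift β≤s = find x∈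
      in  ≤-<-transᵒ β s α′ β≤s (All.lookup S<α′ s∈S)
  approximant (E₁ ⊔ᵉ E₂) S = record
    { base     = A₁.base ⊔ A₂.base
    ; base-wqo = wqo-⊔ A₁.base A₂.base A₁.base-wqo A₂.base-wqo
    ; base<E   = sum A₁.base<E A₂.base<E (≅-refl {A = A₁.base ⊔ A₂.base})
    ; embed    = Sum.map A₁.embed A₂.embed
    ; reflects = λ
        { {inj₁ _} {inj₁ _} x∈ y∈ (inj₁ q) → inj₁ (A₁.reflects (left S x∈) (left S y∈) q)
        ; {inj₂ _} {inj₂ _} x∈ y∈ (inj₂ q) → inj₂ (A₂.reflects (right S x∈) (right S y∈) q)
        }
    }
    where
    lefts : List ∣ ⟦ E₁ ⊔ᵉ E₂ ⟧ ∣ → List ∣ ⟦ E₁ ⟧ ∣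
    lefts = mapMaybe λ { (inj₁ x) → just x ; (inj₂ _) → nothing }
    rights : List ∣ ⟦ E₁ ⊔ᵉ E₂ ⟧ ∣ → List ∣ ⟦ E₂ ⟧ ∣
    rights = mapMaybe λ { (inj₁ _) → nothing ; (inj₂ y) → just y }

    left : ∀ S {x} → Generated ⟦ E₁ ⊔ᵉ E₂ ⟧ S (inj₁ x) → Generated ⟦ E₁ ⟧ (lefts S) x
    left (inj₁ _ ∷ S) (here (inj₁ q)) = here q
    left (inj₁ _ ∷ S) (there q)       = there (left S q)
    left (inj₂ _ ∷ S) (there q)       = left S q

    right : ∀ S {x} → Generated ⟦ E₁ ⊔ᵉ E₂ ⟧ S (inj₂ x) → Generated ⟦ E₂ ⟧ (rights S) x
    right (inj₂ _ ∷ S) (here (inj₂ q)) = here q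
    right (inj₂ _ ∷ S) (there q)       = there (right S q)
    right (inj₁ _ ∷ S) (there q)       = right S q

    module A₁ = Approximant (approximant E₁ (lefts S))
    module A₂ = Approximant (approximant E₂ (rights S))
  approximant (E₁ ×ᵉ E₂) S = record
    { base     = A₁.base ⊗ A₂.base
    ; base-wqo = wqo-⊗ A₁.base A₂.base A₁.base-wqo A₂.base-wqo
    ; base<E   = product A₁.base<E A₂.base<E (≅-refl {A = A₁.base ⊗ A₂.base})
    ; embed    = λ (x , y) → A₁.embed x , A₂.embed y
    ; reflects = λ x∈ y∈ (q , q′) →
        A₁.reflects (Any.map⁺ (Any.map proj₁ x∈)) (Any.map⁺ (Any.map proj₁ y∈)) q ,
        A₂.reflects (Any.map⁺ (Any.map proj₂ x∈)) (Any.map⁺ (Any.map proj₂ y∈)) q′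
    }
    where
    module A₁ = Approximant (approximant E₁ (map proj₁ S))
    module A₂ = Approximant (approximant E₂ (map proj₂ S))
  approximant (words E) S = record
    { base     = Power base (length (concat S))
    ; base-wqo = wqo-power base base-wqo (length (concat S))
    ; base<E   = words (length (concat S)) base<E (≅-refl {A = Power base (length (concat S))})
    ; embed    = λ w → padded w
    ; reflects = λ {w} {v} w∈ v∈ → padded-sublist
        (Below ⟦ E ⟧) (Below base) (Generated ⟦ E ⟧ (concat S)) reflects avoids-pad _ w v
        (≤-length-concat S (Any.map Sublist.length-mono-≤ w∈)) (letters w∈) (letters v∈)
    }
    where
    open Shifted E (concat S) (approximant E _)
    letters : ∀ {w} → Generated ⟦ words E ⟧ S w → All (Generated ⟦ E ⟧ (concat S)) w
    letters = generated-concat ⟦ E ⟧ (Below ⟦ words E ⟧) sublist⇒hoare S _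
  approximant (M⋄ E) S = record
    { base     = MultisetsOfSize (length (concat S)) base
    ; base-wqo = wqo-multisetsOfSize base base-wqo (length (concat S))
    ; base<E   = M⋄ (length (concat S)) base<E (≅-refl {A = MultisetsOfSize (length (concat S)) base})
    ; embed    = λ M → tabulate (padded {length (concat S)} M) , length-tabulate (padded M)
    ; reflects = λ {M} {N} M∈ N∈ (f , q) →
        let match g r = padded-match
              (Below ⟦ E ⟧) (Below base) (Generated ⟦ E ⟧ (concat S)) reflects avoids-pad (length (concat S)) M N
              (≤-length-concat S (Any.map (λ (f , _) → Fin.injective⇒≤ (Injection.injective f)) M∈))
              (elements M∈) (elements N∈) (tabulate-match⁻ {u = padded M} {padded N} (match f q))
        in  g , r
    }
    where
    open Shifted E (concat S) (approximant E _)
    elements : ∀ {M} → Generated ⟦ M⋄ E ⟧ S M → All (Generated ⟦ E ⟧ (concat S)) M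
    elements = generated-concat ⟦ E ⟧ (Below ⟦ M⋄ E ⟧) (λ (f , q) → match⇒hoare (match f q)) S _
  approximant (Pf E) S = record
    { base     = FiniteSubsets base
    ; base-wqo = wqo-finiteSubsets base base-wqo
    ; base<E   = Pf base<E (≅-refl {A = FiniteSubsets base})
    ; embed    = map embed
    ; reflects = λ {T} {T′} T∈ T′∈ q → All.zipWith
        (λ (x∈ , r) → let y , y∈T′ , fx≤fy = find (Any.map⁻ r) in
           lose y∈T′ (reflects x∈ (All.lookup (elements T′∈) y∈T′) fx≤fy))
        (elements T∈ , All.map⁻ q)
    }
    where
    open Approximant (approximant E (concat S))
    elements : ∀ {T} → Generated ⟦ Pf E ⟧ S T → All (Generated ⟦ E ⟧ (concat S)) T
    elements = generated-concat ⟦ E ⟧ (Below ⟦ Pf E ⟧) id S _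

  -- Completions of the constructions

  module _ {A₁ E₁ A₂ E₂ : QO ℓ} (C₁ : Completion A₁ E₁) (C₂ : Completion A₂ E₂) where
    private
      module C₁ = Completion C₁
      module C₂ = Completion C₂

    ⊗-completion : Completion (A₁ ⊗ A₂) (E₁ ⊗ E₂)
    ⊗-completion = record
      { Code      = C₁.Code × C₂.Code
      ; point     = λ (e , f) → C₁.point e , C₂.point f
      ; _∈ᶜ_      = λ (x , y) (e , f) → x C₁.∈ᶜ e × y C₂.∈ᶜ f
      ; ∈-up      = λ (x∈ , y∈) (q , q′) → C₁.∈-up x∈ q , C₂.∈-up y∈ q′
      ; ∈-down    = λ (q , q′) (x∈ , y∈) → C₁.∈-down q x∈ , C₂.∈-down q′ y∈
      ; generic   = λ (e , f) K →
          let x , x∈e , x-above = C₁.generic e (map proj₁ K)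
              y , y∈f , y-above = C₂.generic f (map proj₂ K)
          in  (x , y) , (x∈e , y∈f) ,
              All.zipWith (λ (q , q′) (x∈ , y∈) → q x∈ , q′ y∈) (All.map⁻ x-above , All.map⁻ y-above)
      ; top       = cartesianProductWith _,_ C₁.top C₂.top
      ; top-all   = λ (x , y) → Any.cartesianProductWith⁺ _,_ _,_ (C₁.top-all x) (C₂.top-all y)
      ; residual  = residual-⊗
      ; residual⁺ = residual-⊗⁺
      ; residual⁻ = residual-⊗⁻
      }
      where
      _∈′_ : ∣ A₁ ⊗ A₂ ∣ → C₁.Code × C₂.Code → Set _
      (x , y) ∈′ (e , f) = x C₁.∈ᶜ e × y C₂.∈ᶜ f

      -- A pair fails to be above `(x , y)` in one of the two coordinates, so the residual is a
      -- union of products with one factor shrunk. `residualₚ` is the `n`-fold form.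
      residual-⊗ : C₁.Code × C₂.Code → ∣ A₁ ⊗ A₂ ∣ → List (C₁.Code × C₂.Code)
      residual-⊗ (e , f) (x , y) = map (_, f) (C₁.residual e x) ++ map (e ,_) (C₂.residual f y)

      residual-⊗⁺ : ∀ {ef xy xy′} → xy′ ∈′ ef → ¬ xy ≤[ A₁ ⊗ A₂ ] xy′ →
        Any (xy′ ∈′_) (residual-⊗ ef xy)
      residual-⊗⁺ {e , f} {x , y} {x′ , y′} (x′∈e , y′∈f) ≰ with em {P = x ≤[ A₁ ] x′}
      ... | no  x≰x′ = Any.++⁺ˡ (Any.map⁺ (Any.map (_, y′∈f) (C₁.residual⁺ x′∈e x≰x′)))
      ... | yes x≤x′ = Any.++⁺ʳ (map (_, f) (C₁.residual e x))
        (Any.map⁺ (Any.map (x′∈e ,_) (C₂.residual⁺ y′∈f λ y≤y′ → ≰ (x≤x′ , y≤y′))))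

      residual-⊗⁻ : ∀ {ef xy xy′} → Any (xy′ ∈′_) (residual-⊗ ef xy) →
        xy′ ∈′ ef × ¬ xy ≤[ A₁ ⊗ A₂ ] xy′
      residual-⊗⁻ {e , f} {x , y} q with Any.++⁻ (map (_, f) (C₁.residual e x)) q
      ... | inj₁ q₁ =
        let g , g∈ , x′∈g , y′∈f = find (Any.map⁻ q₁)
            x′∈e , x≰x′          = C₁.residual⁻ (lose g∈ x′∈g)
        in  (x′∈e , y′∈f) , x≰x′ ∘ proj₁
      ... | inj₂ q₂ =
        let g , g∈ , x′∈e , y′∈g = find (Any.map⁻ q₂)
            y′∈f , y≰y′          = C₂.residual⁻ (lose g∈ y′∈g)
        in  (x′∈e , y′∈f) , y≰y′ ∘ proj₂

    ⊔-completion : Completion (A₁ ⊔ A₂) (E₁ ⊔ E₂)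
    ⊔-completion = record
      { Code      = C₁.Code ⊎ C₂.Code
      ; point     = Sum.map C₁.point C₂.point
      ; _∈ᶜ_      = _∈′_
      ; ∈-up      = λ
          { {e = inj₁ _} {inj₁ _} (inj₁ x∈) (inj₁ q) → inj₁ (C₁.∈-up x∈ q)
          ; {e = inj₂ _} {inj₂ _} (inj₂ y∈) (inj₂ q) → inj₂ (C₂.∈-up y∈ q)
          }
      ; ∈-down    = λ
          { (inj₁ q) (inj₁ x∈) → inj₁ (C₁.∈-down q x∈)
          ; (inj₂ q) (inj₂ y∈) → inj₂ (C₂.∈-down q y∈)
          }
      ; generic   = λ
          { (inj₁ e) K → let x , x∈e , above = C₁.generic e (lefts K) in
              inj₁ x , inj₁ x∈e , above-lefts K above
          ; (inj₂ f) K → let y , y∈f , above = C₂.generic f (rights K) in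
              inj₂ y , inj₂ y∈f , above-rights K above
          }
      ; top       = map inj₁ C₁.top ++ map inj₂ C₂.top
      ; top-all   = λ
          { (inj₁ x) → Any.++⁺ˡ (Any.map⁺ (Any.map inj₁ (C₁.top-all x)))
          ; (inj₂ y) → Any.++⁺ʳ (map inj₁ C₁.top) (Any.map⁺ (Any.map inj₂ (C₂.top-all y)))
          }
      ; residual  = residual-⊔
      ; residual⁺ = λ
          { {x = inj₁ _} (inj₁ x∈) ≰ → Any.map⁺ (Any.map inj₁ (C₁.residual⁺ x∈ (≰ ∘ inj₁)))
          ; {x = inj₂ _} (inj₁ x∈) ≰ → here (inj₁ x∈)
          ; {x = inj₁ _} (inj₂ y∈) ≰ → here (inj₂ y∈)
          ; {x = inj₂ _} (inj₂ y∈) ≰ → Any.map⁺ (Any.map inj₂ (C₂.residual⁺ y∈ (≰ ∘ inj₂)))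
          }
      ; residual⁻ = λ {e} {x} {y} → residual-⊔⁻ e x y
      }
      where
      _∈′_ : ∣ A₁ ⊔ A₂ ∣ → C₁.Code ⊎ C₂.Code → Set _
      _∈′_ = ⊎.Pointwise C₁._∈ᶜ_ C₂._∈ᶜ_

      lefts : List (C₁.Code ⊎ C₂.Code) → List C₁.Code
      lefts = mapMaybe λ { (inj₁ e) → just e ; (inj₂ _) → nothing }

      rights : List (C₁.Code ⊎ C₂.Code) → List C₂.Code
      rights = mapMaybe λ { (inj₁ _) → nothing ; (inj₂ f) → just f }

      above-lefts : ∀ {x e} K → All (λ g → x C₁.∈ᶜ g → C₁.point e ≤[ E₁ ] C₁.point g) (lefts K) →
        All (λ g → inj₁ x ∈′ g → inj₁ (C₁.point e) ≤[ E₁ ⊔ E₂ ] Sum.map C₁.point C₂.point g) K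
      above-lefts []           _        = []
      above-lefts (inj₁ _ ∷ K) (q ∷ qs) = (λ { (inj₁ x∈) → inj₁ (q x∈) }) ∷ above-lefts K qs
      above-lefts (inj₂ _ ∷ K) qs       = (λ ()) ∷ above-lefts K qs

      above-rights : ∀ {y f} K → All (λ g → y C₂.∈ᶜ g → C₂.point f ≤[ E₂ ] C₂.point g) (rights K) →
        All (λ g → inj₂ y ∈′ g → inj₂ (C₂.point f) ≤[ E₁ ⊔ E₂ ] Sum.map C₁.point C₂.point g) K
      above-rights []           _        = []
      above-rights (inj₂ _ ∷ K) (q ∷ qs) = (λ { (inj₂ y∈) → inj₂ (q y∈) }) ∷ above-rights K qs
      above-rights (inj₁ _ ∷ K) qs       = (λ ()) ∷ above-rights K qs

      residual-⊔ : C₁.Code ⊎ C₂.Code → ∣ A₁ ⊔ A₂ ∣ → List (C₁.Code ⊎ C₂.Code)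
      residual-⊔ (inj₁ e) (inj₁ x) = map inj₁ (C₁.residual e x)
      residual-⊔ (inj₁ e) (inj₂ _) = inj₁ e ∷ []
      residual-⊔ (inj₂ f) (inj₁ _) = inj₂ f ∷ []
      residual-⊔ (inj₂ f) (inj₂ y) = map inj₂ (C₂.residual f y)

      residual-⊔⁻ : ∀ e x y → Any (y ∈′_) (residual-⊔ e x) → y ∈′ e × ¬ x ≤[ A₁ ⊔ A₂ ] y
      residual-⊔⁻ (inj₁ e) (inj₁ x) (inj₁ y) q =
        let y∈e , x≰y = C₁.residual⁻ (Any.map ⊎.drop-inj₁ (Any.map⁻ q))
        in  inj₁ y∈e , x≰y ∘ ⊎.drop-inj₁
      residual-⊔⁻ (inj₁ e) (inj₁ x) (inj₂ y) q with () ← proj₂ (Any.satisfied (Any.map⁻ q))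
      residual-⊔⁻ (inj₁ e) (inj₂ x) _        (here (inj₁ y∈e)) = inj₁ y∈e , λ ()
      residual-⊔⁻ (inj₂ f) (inj₁ x) _        (here (inj₂ y∈f)) = inj₂ y∈f , λ ()
      residual-⊔⁻ (inj₂ f) (inj₂ x) (inj₂ y) q =
        let y∈f , x≰y = C₂.residual⁻ (Any.map ⊎.drop-inj₂ (Any.map⁻ q))
        in  inj₂ y∈f , x≰y ∘ ⊎.drop-inj₂
      residual-⊔⁻ (inj₂ f) (inj₂ x) (inj₁ y) q with () ← proj₂ (Any.satisfied (Any.map⁻ q))

  module _ {A E : QO ℓ} (n : ℕ) (C : Completion A E) where
    open Completion C
    private
      replace : (Fin n → Code) → Fin n → Code → Fin n → Code
      replace v i e = updateAt v i (const e)

      _∈ₚ_ : (Fin n → ∣ A ∣) → (Fin n → Code) → Set _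
      y ∈ₚ v = ∀ i → y i ∈ᶜ v i

      replace⁺ : ∀ {y v i e} → y ∈ₚ v → y i ∈ᶜ e → y ∈ₚ replace v i e
      replace⁺ {y} {v} {i} {e} y∈v yᵢ∈e j with j Fin.≟ i
      ... | yes refl = subst (y i ∈ᶜ_) (sym (updateAt-updates i v)) yᵢ∈e
      ... | no  j≢i  = subst (y j ∈ᶜ_) (sym (updateAt-minimal j i v j≢i)) (y∈v j)

      replace⁻-at : ∀ {y v i e} → y ∈ₚ replace v i e → y i ∈ᶜ e
      replace⁻-at {y} {v} {i} y∈ = subst (y i ∈ᶜ_) (updateAt-updates i v) (y∈ i)

      replace⁻-off : ∀ {y v i e} → y ∈ₚ replace v i e → y i ∈ᶜ v i → y ∈ₚ v
      replace⁻-off {y} {v} {i} y∈ yᵢ∈vᵢ j with j Fin.≟ i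
      ... | yes refl = yᵢ∈vᵢ
      ... | no  j≢i  = subst (y j ∈ᶜ_) (updateAt-minimal j i v j≢i) (y∈ j)

      residualₚ : (Fin n → Code) → (Fin n → ∣ A ∣) → List (Fin n → Code)
      residualₚ v x = concatMap (λ i → map (replace v i) (residual (v i) (x i))) (allFin n)

      residualₚ⁻ : ∀ {v x y} → Any (y ∈ₚ_) (residualₚ v x) → y ∈ₚ v × ¬ (∀ i → x i ≤[ A ] y i)
      residualₚ⁻ {v} {x} {y} y∈ =
        let i , y∈i       = Any.satisfied (Any.concatMap⁻
              (λ i → map (replace v i) (residual (v i) (x i))) {xs = allFin n} y∈)
            e , e∈ , y∈′  = find (Any.map⁻ y∈i)
            yᵢ∈vᵢ , xᵢ≰yᵢ = residual⁻ (lose e∈ (replace⁻-at y∈′))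
        in  replace⁻-off y∈′ yᵢ∈vᵢ , λ x≤y → xᵢ≰yᵢ (x≤y i)

    power-completion : Completion (Power A n) (Power E n)
    power-completion = record
      { Code      = Fin n → Code
      ; point     = point ∘_
      ; _∈ᶜ_      = _∈ₚ_
      ; ∈-up      = λ x∈v q i → ∈-up (x∈v i) (q i)
      ; ∈-down    = λ q x∈v i → ∈-down (q i) (x∈v i)
      ; generic   = λ v K →
          let gen i = generic (v i) (map (λ w → w i) K)
          in  proj₁ ∘ gen , proj₁ ∘ proj₂ ∘ gen ,
              All.tabulate λ w∈K x∈w i → All.lookup (All.map⁻ (proj₂ (proj₂ (gen i)))) w∈K (x∈w i)
      ; top       = functions n top
      ; top-all   = λ x → functions⁺ (top-all ∘ x)
      ; residual  = residualₚ
      ; residual⁺ = λ y∈v x≰y → let i , xᵢ≰yᵢ = ¬∀⇒∃¬ x≰y in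
          Any.concatMap⁺ _ (lose (∈-allFin i) (Any.map⁺ (Any.map (replace⁺ y∈v) (residual⁺ (y∈v i) xᵢ≰yᵢ))))
      ; residual⁻ = residualₚ⁻
      }

  module _ {A E : QO ℓ} (C : Completion A E) where
    open Completion C

    -- A code is a finite union of coded ideals, standing for the finite sets contained in it. Its
    -- generic set collects one generic point per member, each chosen against all codes occurring in
    -- `K`. A set is not above `T` iff some `t` in `T` is below none of its elements, hence one
    -- residual for each `t`.
    finiteSubsets-completion : Completion (FiniteSubsets A) (FiniteSubsets E)
    finiteSubsets-completion = record
      { Code      = List Code
      ; point     = map point
      ; _∈ᶜ_      = _⊆_
      ; ∈-up      = λ T⊆S S≤S′ → All.map (λ t∈S →
          let e , e∈S , t∈e = find t∈S
              q             = All.lookup (All.map⁻ S≤S′) e∈S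
          in  Any.map (∈-up t∈e) (Any.map⁻ q)) T⊆S
      ; ∈-down    = λ T≤T′ T′⊆S → All.map (λ t≤T′ →
          let t′ , t′∈T′ , t≤t′ = find t≤T′
          in  Any.map (∈-down t≤t′) (All.lookup T′⊆S t′∈T′)) T≤T′
      ; generic   = λ S K →
          let gen e = generic e (concat K)
          in  map (proj₁ ∘ gen) S ,
              All.map⁺ (All.tabulate λ {e} e∈S → lose e∈S (proj₁ (proj₂ (gen e)))) ,
              All.tabulate λ S′∈K T⊆S′ → All.map⁺ (All.map
                (λ {e} x∈S′ →
                  let f , f∈S′ , x∈f = find x∈S′
                      above          = All.lookup (All.concat⁻ (proj₂ (proj₂ (gen e)))) S′∈K
                  in  Any.map⁺ (lose f∈S′ (All.lookup above f∈S′ x∈f)))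
                (All.map⁻ T⊆S′))
      ; top       = top ∷ []
      ; top-all   = λ T → here (All.tabulate λ {t} _ → top-all t)
      ; residual  = λ S T → map (residual* S) T
      ; residual⁺ = λ {S} {T} {T′} T′⊆S T≰T′ → Any.map⁺ (Any.map
          (λ t≰T′ → All.tabulate λ t′∈T′ → residual*⁺ (All.lookup T′⊆S t′∈T′) (λ t≤t′ → t≰T′ (lose t′∈T′ t≤t′)))
          (All.¬All⇒Any¬ (λ _ → em) T T≰T′))
      ; residual⁻ = λ {S} {T} {T′} q →
          let t , t∈T , T′⊆res = find (Any.map⁻ {xs = T} q)
          in  All.map (proj₁ ∘ residual*⁻ {S}) T′⊆res , λ T≤T′ →
                let t′ , t′∈T′ , t≤t′ = find (All.lookup T≤T′ t∈T)
                in  proj₂ (residual*⁻ {S} (All.lookup T′⊆res t′∈T′)) t≤t′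
      }
      where
      _⊆_ : List ∣ A ∣ → List Code → Set _
      T ⊆ S = All (λ t → Any (t ∈ᶜ_) S) T

  injections : ∀ n → List (Fin n ↣ Fin n)
  injections n = concatMap asInjection (functions n (allFin n))
    module Injections where
    asInjection : (Fin n → Fin n) → List (Fin n ↣ Fin n)
    asInjection f with em {P = ∀ {i j} → f i ≡ f j → i ≡ j}
    ... | yes inj = mk↣ {to = f} inj ∷ []
    ... | no  _   = []

  injections⁺ : ∀ {n} (σ : Fin n ↣ Fin n) →
    Any (λ τ → ∀ i → Injection.to σ i ≡ Injection.to τ i) (injections n)
  injections⁺ {n} σ = Any.concatMap⁺ (Injections.asInjection n)
    (Any.map (λ {f} → found f) (functions⁺ λ i → ∈-allFin (Injection.to σ i)))
    where
    found : ∀ f → (∀ i → Injection.to σ i ≡ f i) →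
      Any (λ τ → ∀ i → Injection.to σ i ≡ Injection.to τ i) (Injections.asInjection n f)
    found f σ≗f with em {P = ∀ {i j} → f i ≡ f j → i ≡ j}
    ... | yes inj = here σ≗f
    ... | no ¬inj = ⊥-elim (¬inj λ {i} {j} eq →
      Injection.injective σ (trans (σ≗f i) (trans eq (sym (σ≗f j)))))

  module _ {A E : QO ℓ} (n : ℕ) (C : Completion A E) where
    private
      open Completion C using (Code; point; _∈ᶜ_; ∈-up; ∈-down; generic)
      module P = Completion (power-completion n C)

      _∈ₘ_ : (Fin n → ∣ A ∣) → (Fin n → Code) → Set _
      y ∈ₘ v = Match _∈ᶜ_ y v

      permuted : (Fin n → ∣ A ∣) → List (Fin n → ∣ A ∣)
      permuted x = map (λ τ → x ∘ Injection.to τ) (injections n)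

      residualₘ : (Fin n → Code) → (Fin n → ∣ A ∣) → List (Fin n → Code)
      residualₘ v x = P.residuals (v ∷ []) (permuted x)

      -- Reordering y puts it into the product of the ideals in v, and x is not below y
      -- iff no reordering of x is pointwise below it.
      residualₘ⁺ : ∀ {v x y} → y ∈ₘ v → ¬ Match (Below A) x y → Any (y ∈ₘ_) (residualₘ v x)
      residualₘ⁺ {v} {x} {y} y∈v x≰y with match⇒reindexed y∈v
      ... | σ , yσ∈v = Any.map (reindexed⇒match σ) (P.residuals⁺ {v ∷ []} {permuted x} (here yσ∈v)
        (All.map⁺ (All.tabulate λ {τ} _ xτ≤yσ →
          let match f q = reindexed⇒match {R = Below A} {v = y ∘ Injection.to σ} τ xτ≤yσ in x≰y (match (σ ↣-∘ f) q))))

      residualₘ⁻ : ∀ {v x y} → Any (y ∈ₘ_) (residualₘ v x) → y ∈ₘ v × ¬ Match (Below A) x y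
      residualₘ⁻ {v} {x} {y} y∈ =
        let u , u∈ , y∈u = find y∈
            σ , yσ∈u     = match⇒reindexed y∈u
            yσ∈v , xτ≰yσ = P.residuals⁻ {v ∷ []} {permuted x} (lose u∈ yσ∈u)
        in  reindexed⇒match σ (Any.singleton⁻ yσ∈v) , λ x≤y →
              let τ , xτ≤y      = match⇒reindexed x≤y
                  ρ , ρ∈ , τσ≗ρ = find (injections⁺ (τ ↣-∘ σ))
              in  All.lookup (All.map⁻ xτ≰yσ) ρ∈ λ k →
                    subst (λ i → x i ≤[ A ] y (Injection.to σ k)) (τσ≗ρ k) (xτ≤y (Injection.to σ k))

    families-completion : Completion (Families n A) (Families n E)
    families-completion = record
      { Code      = Fin n → Code
      ; point     = point ∘_
      ; _∈ᶜ_      = _∈ₘ_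
      ; ∈-up      = λ x∈v (match f q) → match-trans {S = λ e f → point e ≤[ E ] point f} ∈-up x∈v (match f q)
      ; ∈-down    = match-trans ∈-down
      ; generic   = λ v K →
          -- Each entry is generic against every code occurring in any family of `K`; a matching of
          -- these entries into a family of codes is then a matching of the codes themselves.
          let gen i = generic (v i) (concatMap tabulate K)
              above i = All.map⁻ (All.concat⁻ (proj₂ (proj₂ (gen i))))
          in  proj₁ ∘ gen , match (↣-id _) (proj₁ ∘ proj₂ ∘ gen) ,
              All.tabulate λ w∈K (match f q) → match f λ i →
                All.tabulate⁻ (All.lookup (above i) w∈K) (Injection.to f i) (q i)
      ; top       = P.top
      ; top-all   = λ x → Any.map (match (↣-id _)) (P.top-all x)
      ; residual  = residualₘ
      ; residual⁺ = residualₘ⁺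
      ; residual⁻ = residualₘ⁻
      }

    private
      members : ∣ MultisetsOfSize n A ∣ → Fin n → ∣ A ∣
      members (xs , eq) = lookup xs ∘ cast (sym eq)

      members⁺ : ∀ {M} → Match _≡_ (lookup (proj₁ M)) (members M)
      members⁺ {xs , eq} = match-cast eq λ i →
        cong (lookup xs) (sym (Fin.cast-involutive (sym eq) eq i))

      members⁻ : ∀ {M} → Match _≡_ (members M) (lookup (proj₁ M))
      members⁻ {xs , eq} = match-cast (sym eq) λ _ → refl

    multisets-completion : Completion (MultisetsOfSize n A) (Multisets E)
    multisets-completion = transport {A = Families n A} {MultisetsOfSize n A} {Families n E} {Multisets E}
      members tabulate
      (λ {M} {N} (f , q) → match-trans (λ { refl r → r }) (members⁻ {M})
        (match-trans {R = Below A} (λ { r refl → r }) (match f q) (members⁺ {N})))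
      (λ {M} {N} q → let match f r = match-trans {T = Below A} (λ { refl r → r }) (members⁺ {M})
                           (match-trans (λ { r refl → r }) q (members⁻ {N})) in f , r)
      (λ u → (tabulate u , length-tabulate u) , pointwise (λ i → Preorder.reflexive A (≡⇒≈ (lookup-tabulate u i))) ,
        pointwise λ i → Preorder.reflexive A (≡⇒≈ (sym (lookup-tabulate u i))))
      (λ q → let match f r = tabulate-match⁺ q in f , r)
      (λ (f , q) → tabulate-match⁻ (match f q))
      families-completion
      where
      pointwise : ∀ {u v : Fin n → ∣ A ∣} → (∀ i → u i ≤[ A ] v i) → Match (Below A) u v
      pointwise = match (↣-id _)
      ≡⇒≈ : ∀ {x y} → x ≡ y → Preorder._≈_ A x y
      ≡⇒≈ refl = Preorder.Eq.refl A

  words-completion : {A E : QO ℓ} (n : ℕ) → Completion A E → Completion (Power A n) (Words E)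
  words-completion {A = A} {E} n C = transport {A = Power A n} {Power A n} {Power E n} {Words E} id tabulate
    id id (λ x → x , (λ _ → Preorder.refl A) , λ _ → Preorder.refl A)
    (tabulate-sublist⁺ _ _) (tabulate-sublist⁻ _ _) (power-completion n C)

  module _ {α α′ : Ord ℓ} (α′<α : α′ <ᵒ α) where
    private
      Code : Set (lsuc ℓ)
      Code = Σ[ β ∈ Ord ℓ ] 0ᵒ {ℓ} <ᵒ β × β ≤ᵒ α′

      -- The largest member of `K` below `β`, or 0 if there is none: it lies outside the segment of
      -- every `δ < β` in `K`.
      generic : (β : Ord ℓ) → 0ᵒ {ℓ} <ᵒ β → (K : List Code) →
        Σ[ γ ∈ Ord ℓ ] γ <ᵒ β × All (λ e → γ <ᵒ proj₁ e → β ≤ᵒ proj₁ e) K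
      generic β 0<β [] = 0ᵒ , 0<β , []
      generic β 0<β ((δ , _) ∷ K) with generic β 0<β K
      ... | γ , γ<β , above with ≤ᵒ-or->ᵒ β δ
      ...   | inj₁ β≤δ = γ , γ<β , (λ _ → β≤δ) ∷ above
      ...   | inj₂ δ<β with ≤ᵒ-or->ᵒ γ δ
      ...     | inj₁ γ≤δ = δ , δ<β , (λ δ<δ → ⊥-elim (<ᵒ-irrefl δ δ<δ)) ∷
        All.map (λ {e} q δ<e → q (≤-<-transᵒ γ δ (proj₁ e) γ≤δ δ<e)) above
      ...     | inj₂ δ<γ = γ , γ<β ,
        (λ γ<δ → ⊥-elim (<ᵒ-irrefl δ (<-≤-transᵒ δ γ δ δ<γ (<ᵒ⇒≤ᵒ γ δ γ<δ)))) ∷ above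

      -- The empty set is not an ideal, hence has no code: it has no generic point.
      ideal : ∀ β → β ≤ᵒ α′ → List Code
      ideal β β≤α′ with em {P = 0ᵒ {ℓ} <ᵒ β}
      ... | yes 0<β = (β , 0<β , β≤α′) ∷ []
      ... | no  _   = []

      ideal⁺ : ∀ β β≤α′ {γ : Ord ℓ} → γ <ᵒ β → Any (λ e → Lift (lsuc ℓ) (γ <ᵒ proj₁ e)) (ideal β β≤α′)
      ideal⁺ β β≤α′ {γ} γ<β with em {P = 0ᵒ {ℓ} <ᵒ β}
      ... | yes _   = here (lift γ<β)
      ... | no  0≮β = ⊥-elim (0≮β (≤-<-transᵒ 0ᵒ γ β (0≤ᵒ γ) γ<β))

      ideal⁻ : ∀ β β≤α′ {γ : Ord ℓ} → Any (λ e → Lift (lsuc ℓ) (γ <ᵒ proj₁ e)) (ideal β β≤α′) → γ <ᵒ β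
      ideal⁻ β β≤α′ q with em {P = 0ᵒ {ℓ} <ᵒ β}
      ideal⁻ β β≤α′ (here (lift γ<β)) | yes _ = γ<β

      -- The points below `β` that are not above `γ` form the segment of length `min β γ`, which is
      -- empty for `γ = 0`.
      residual : Code → ∣ segment α′ ∣ → List Code
      residual (β , 0<β , β≤α′) (γ , γ<α′) with ≤ᵒ-or->ᵒ β γ
      ... | inj₁ _ = (β , 0<β , β≤α′) ∷ []
      ... | inj₂ _ = ideal γ (<ᵒ⇒≤ᵒ γ α′ γ<α′)

    segment-completion : Completion (segment α′) (segment α)
    segment-completion = record
      { Code      = Code
      ; point     = λ (β , _ , β≤α′) → β , ≤-<-transᵒ β α′ α β≤α′ α′<α
      ; _∈ᶜ_      = λ (γ , _) (β , _) → Lift _ (γ <ᵒ β)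
      ; ∈-up      = λ {(γ , _)} {(β , _)} {(δ , _)} (lift γ<β) (lift β≤δ) → lift (<-≤-transᵒ γ β δ γ<β β≤δ)
      ; ∈-down    = λ {(γ , _)} {(δ , _)} {(β , _)} (lift γ≤δ) (lift δ<β) → lift (≤-<-transᵒ γ δ β γ≤δ δ<β)
      ; generic   = λ (β , 0<β , β≤α′) K →
          let γ , γ<β , above = generic β 0<β K
          in  (γ , <-≤-transᵒ γ β α′ γ<β β≤α′) , lift γ<β , All.map (λ q (lift γ<δ) → lift (q γ<δ)) above
      ; top       = ideal α′ (≤ᵒ-refl α′)
      ; top-all   = λ (γ , γ<α′) → ideal⁺ α′ (≤ᵒ-refl α′) γ<α′
      ; residual  = residual
      ; residual⁺ = λ {e} {x} {y} → residual⁺ e x y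
      ; residual⁻ = λ {e} {x} {y} → residual⁻ e x y
      }
      where
      residual⁺ : ∀ e (x y : ∣ segment α′ ∣) → Lift (lsuc ℓ) (proj₁ y <ᵒ proj₁ e) → ¬ x ≤[ segment α′ ] y →
        Any (λ e → Lift (lsuc ℓ) (proj₁ y <ᵒ proj₁ e)) (residual e x)
      residual⁺ (β , 0<β , β≤α′) (γ , γ<α′) (δ , _) δ<β γ≰δ with ≤ᵒ-or->ᵒ β γ
      ... | inj₁ _ = here δ<β
      ... | inj₂ _ with ≤ᵒ-or->ᵒ γ δ
      ...   | inj₁ γ≤δ = ⊥-elim (γ≰δ (lift γ≤δ))
      ...   | inj₂ δ<γ = ideal⁺ γ _ δ<γ

      residual⁻ : ∀ e (x y : ∣ segment α′ ∣) →
        Any (λ e → Lift (lsuc ℓ) (proj₁ y <ᵒ proj₁ e)) (residual e x) →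
        Lift (lsuc ℓ) (proj₁ y <ᵒ proj₁ e) × ¬ x ≤[ segment α′ ] y
      residual⁻ (β , 0<β , β≤α′) (γ , γ<α′) (δ , _) q with ≤ᵒ-or->ᵒ β γ
      residual⁻ (β , _) (γ , _) (δ , _) (here (lift δ<β)) | inj₁ β≤γ = lift δ<β ,
        λ (lift γ≤δ) → <ᵒ-irrefl δ (<-≤-transᵒ δ β δ δ<β (≤ᵒ-trans β γ δ β≤γ γ≤δ))
      residual⁻ (β , _) (γ , γ<α′) (δ , _) q | inj₂ γ<β =
        let δ<γ = ideal⁻ γ _ q
        in  lift (<-≤-transᵒ δ γ β δ<γ (<ᵒ⇒≤ᵒ γ β γ<β)) ,
            λ (lift γ≤δ) → <ᵒ-irrefl δ (<-≤-transᵒ δ γ δ δ<γ γ≤δ)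

  completion : {E : Expr ℓ} {A : QO (lsuc ℓ)} → A <approx E → Completion A ⟦ E ⟧
  completion (ordinal α′<α iso) = ≅-completion iso (segment-completion α′<α)
  completion (sum q₁ q₂ iso)     = ≅-completion iso (⊔-completion (completion q₁) (completion q₂))
  completion (product q₁ q₂ iso) = ≅-completion iso (⊗-completion (completion q₁) (completion q₂))
  completion (words n q iso)     = ≅-completion iso (words-completion n (completion q))
  completion (M⋄ n q iso)        = ≅-completion iso (multisets-completion n (completion q))
  completion (Pf q iso)          = ≅-completion iso (finiteSubsets-completion (completion q))

  -- Comparison of ranks

  DecreasingSets : (A : QO ℓ) → Rel (List (List ∣ A ∣)) ℓ
  DecreasingSets A = Child (StrictlyBelow (FiniteSubsets A))

  BadSequences : (A : QO ℓ) → Rel (List ∣ A ∣) ℓ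
  BadSequences A = Child (NotAbove A)

  -- The bad sequence lags one step behind: its entries are picked from the differences of
  -- consecutive sets.
  module _ {A B : QO ℓ} (S : List ∣ A ∣) (embed : ∣ A ∣ → ∣ B ∣)
    (reflects : ∀ {x y} → Generated A S x → Generated A S y → embed x ≤[ B ] embed y → x ≤[ A ] y) where

    private
      Removed : List ∣ A ∣ → ∣ B ∣ → Set ℓ
      Removed T u = ∃[ x ] u ≡ embed x × Generated A S x × ¬ Generated A T x

      Sim : List (List ∣ A ∣) → List ∣ B ∣ → Set ℓ
      Sim []      us = Lift ℓ ⊥
      Sim (T ∷ _) us = T ≤[ FiniteSubsets A ] S × All (Removed T) us

      step : ∀ {Ts Ts′ us} → Sim Ts us → DecreasingSets A Ts′ Ts →
        ∃[ us′ ] BadSequences B us′ us × Sim Ts′ us′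
      step {T ∷ _} {us = us} (T≤S , removed) (extend {T′} ((T′≤T , T≰T′) ∷ _)) =
        let x , x∈T , x∉T′ = find (All.¬All⇒Any¬ (λ _ → em) T T≰T′)
            x∈S            = All.lookup T≤S x∈T
            -- Every earlier entry comes from a point outside the down-closure of `T`, while `x`
            -- belongs to `T`; so that point cannot lie below `x`.
            bad : All (λ u → ¬ u ≤[ B ] embed x) us
            bad = All.map (λ { (y , refl , y∈S , y∉T) fy≤fx → y∉T (lose x∈T (reflects y∈S x∈S fy≤fx)) }) removed
        in  embed x ∷ us , extend bad ,
            Preorder.trans (FiniteSubsets A) {T′} {T} {S} T′≤T T≤S ,
            (x , refl , x∈S , x∉T′) ∷
            All.map (λ (y , u≡ , y∈S , y∉T) → y , u≡ , y∈S , λ y∈T′ → y∉T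
              (let t′ , t′∈T′ , y≤t′ = find y∈T′
               in  Any.map (Preorder.trans A y≤t′) (All.lookup T′≤T t′∈T′))) removed

    decreasing≤bad : (p : Acc (DecreasingSets A) (S ∷ [])) (q : Acc (BadSequences B) []) → rank p ≤ᵒ rank q
    decreasing≤bad p q = rank-simulation Sim (λ {Ts} {Ts′} {us} → step {Ts} {Ts′} {us}) p q
      (Preorder.refl (FiniteSubsets A) {S} , [])

  module _ {A E : QO ℓ} (C : Completion A E) where
    open Completion C

    -- Primality of ideals: a point of `e` that is generic for `L` can lie in a code of `L` only if
    -- that code is above `e`.
    inclusion⇒≤ : ∀ K L → (∀ {x} → Any (x ∈ᶜ_) K → Any (x ∈ᶜ_) L) →
      map point K ≤[ FiniteSubsets E ] map point L
    inclusion⇒≤ K L K⊆L = All.map⁺ (All.tabulate λ {e} e∈K →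
      let x , x∈e , above = generic e L
          f , f∈L , x∈f   = find (K⊆L (lose e∈K x∈e))
      in  Any.map⁺ (lose f∈L (All.lookup above f∈L x∈f)))

    ≤⇒inclusion : ∀ K L → map point K ≤[ FiniteSubsets E ] map point L →
      ∀ {x} → Any (x ∈ᶜ_) K → Any (x ∈ᶜ_) L
    ≤⇒inclusion K L K≤L x∈K =
      let e , e∈K , x∈e = find x∈K
      in  Any.map (∈-up x∈e) (Any.map⁻ (All.lookup (All.map⁻ K≤L) e∈K))

    private
      residue : List ∣ A ∣ → List ∣ E ∣
      residue xs = map point (residuals top xs)

      -- All sets of `Ts` are kept in view because `Child` demands that a new set be strictly below
      -- each of them, not only below the latest.
      Sim : List ∣ A ∣ → List (List ∣ E ∣) → Set ℓ
      Sim xs Ts = All (λ T → residue xs ≤[ FiniteSubsets E ] T) Ts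

      step : ∀ {xs xs′ Ts} → Sim xs Ts → BadSequences A xs′ xs →
        ∃[ Ts′ ] DecreasingSets E Ts′ Ts × Sim xs′ Ts′
      step {xs} {Ts = Ts} sim (extend {x} bad) =
        residue (x ∷ xs) ∷ Ts ,
        -- Strictness is witnessed by `x` itself: badness puts it among the residuals before the
        -- extension, and reflexivity removes it from those after.
        extend (All.map (λ {T} res≤T → shrunk T res≤T , λ T≤res →
          removed (≤⇒inclusion (residuals top xs) (residuals top (x ∷ xs))
            (FS.trans {residue xs} {T} {residue (x ∷ xs)} res≤T T≤res)
            (residuals⁺ {top} {xs} (top-all x) bad))) sim) ,
        FS.refl {residue (x ∷ xs)} ∷ All.map (λ {T} → shrunk T) sim
        where
        module FS = Preorder (FiniteSubsets E)

        shrunk : ∀ T → residue xs ≤[ FiniteSubsets E ] T → residue (x ∷ xs) ≤[ FiniteSubsets E ] T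
        shrunk T = FS.trans {residue (x ∷ xs)} {residue xs} {T}
          (inclusion⇒≤ (residuals top (x ∷ xs)) (residuals top xs) λ y∈ → proj₁ (residual*⁻ {residuals top xs} y∈))

        removed : ¬ Any (x ∈ᶜ_) (residuals top (x ∷ xs))
        removed x∈ = proj₂ (residual*⁻ {residuals top xs} x∈) (Preorder.refl A)

    -- The empty bad sequence already faces one set, the codes of all of `A`; that extra set later
    -- turns the weak inequality into a strict one.
    bad≤decreasing : (p : Acc (BadSequences A) []) (q : Acc (DecreasingSets E) (map point top ∷ [])) →
      rank p ≤ᵒ rank q
    bad≤decreasing p q = rank-simulation Sim (λ {xs} {xs′} {Ts} → step {xs} {xs′} {Ts}) p q
      (Preorder.refl (FiniteSubsets E) {map point top} ∷ [])

mainTheorem14 : (em : ∀ {ℓ} → ExcludedMiddle ℓ) →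
    ∀ {ℓ} (E : Expr ℓ) → NormalForm E →
    Σ[ wqo ∈ IsWQO (FiniteSubsets ⟦ E ⟧) ]
    h em (FiniteSubsets ⟦ E ⟧ , wqo) ≈ᵒ o-weakened em E
mainTheorem14 em E _ = wqo , h≤o , o≤h
  where
  open Classical em
  wqo = wqo-finiteSubsets ⟦ E ⟧ wqo-⟦ E ⟧

  h≤o : h em (FiniteSubsets ⟦ E ⟧ , wqo) ≤ᵒ o-weakened em E
  -- The first set `S` selects the approximation, so the child of the root that it determines is
  -- charged to a single term of the supremum.
  h≤o = rank-upper (o-weakened em E) _ λ { p (extend {S} []) →
    let open Approximant (approximant E S)
        oA = o em (base , base-wqo)
    in  ((base , base-wqo) , base<E) ,
        ≤ᵒ-transʰ (rank p) oA (raise oA) (decreasing≤bad {A = ⟦ E ⟧} {B = base} S embed reflects p _) (≤ᵒ-raise oA) }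

  o≤h : o-weakened em E ≤ᵒ h em (FiniteSubsets ⟦ E ⟧ , wqo)
  o≤h (A , A<E) = ≤-<-transᵒ (raise (o em A)) (o em A) (h em (FiniteSubsets ⟦ E ⟧ , wqo)) (raise-≤ᵒ (o em A))
    (rank-lower (o em A) _ (extend []) (bad≤decreasing {E = ⟦ E ⟧} (completion A<E) _))
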